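{- Let $(G,u)$ and $(H,v)$ be rooted graphs. For any integers $m,h\ge 1$ and $g,k\ge 0$, \begin{align*} \frac{X_{S^{ghk}(G,H,K_m)}}{(m-1)!} &=\sum_{z=0}^{m-1}e_{m-1-z}\,X_{P^{g+h+k+z}(G,H)} -\sum_{\substack{a+b+c=k+m-2\\ a,b,c\ge 0,\ a\le m-1}}(1-a)\,e_a\,X_{G^{b+g}}\,X_{H^{c+h}}\\ &\qquad+\frac{1}{(m-1)!}\sum_{z=0}^{k-1}X_{K_m^{z}}\,X_{P^{g+h+k-z-1}(G,H)}. \end{align*}
   Context: All graphs are finite simple graphs; $X_G=\sum_{\kappa}\prod_{v\in V(G)}x_{\kappa(v)}$ over proper colorings $\kappa:V(G)\to\{1,2,\dots\}$ is the chromatic symmetric function; $e_a$ is the $a$-th elementary symmetric function, $e_0=1$. For rooted graphs $(G,u),(H,v)$ and $k\ge 0$, $P^k(G,H)$ is obtained from disjoint copies of $G,H$ by adding a path of length $k$ linking $u$ and $v$ (identifying them if $k=0$); the tailed graph is $G^k=P^k(G,K_1)$; $K_m$ is the complete graph rooted at any vertex and $K_m^z$ is the lollipop $(K_m)^z$. For nonnegative integers $\tau_1,\tau_2,\tau_3$ and rooted graphs $(G_i,u_i)$, $S^{\tau_1\tau_2\tau_3}(G_1,G_2,G_3)$ is obtained from a spider with center $c$ and three legs (paths from $c$, otherwise disjoint) of lengths $\tau_1,\tau_2,\tau_3$ by identifying the root $u_i$ with the far end of the $i$-th leg (with $c$ if $\tau_i=0$). -}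

module Defs where

open import Data.Nat as ℕ using (ℕ; zero; suc; _+_; _∸_; _≡ᵇ_; _≤ᵇ_)
open import Data.Fin as Fin using (Fin; zero; suc; inject₁; _↑ˡ_; _↑ʳ_; fromℕ; punchOut)
open import Data.Fin.Properties using () renaming (_≟_ to _≟F_)
open import Data.Bool using (Bool; true; false; not; _∧_; if_then_else_)
open import Data.List as List using (List; []; _∷_; _++_; map; concatMap; length; allFin; upTo; zipWith; foldr)
open import Data.Product using (_×_; _,_; proj₁; proj₂)
open import Data.Integer as ℤ using (ℤ; +_)
open import Relation.Nullary using (yes; no)
open import Relation.Nullary.Decidable using (⌊_⌋)
open import Relation.Binary.PropositionalEquality using (_≡_; refl; sym)

record RootedGraph : Set where
  field
    n      : ℕ
    adj    : Fin (suc n) → Fin (suc n) → Bool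
    adj-sym    : ∀ i j → adj i j ≡ adj j i
    adj-irrefl : ∀ i → adj i i ≡ false
    root   : Fin (suc n)

open RootedGraph

-- Working representation for constructed graphs: vertex set Fin N and
-- a list of edges (ordered pairs, read as unordered edges; repeated
-- edges are harmless for proper colourings; constructions below never
-- create loops when applied to simple graphs).

record EGraph : Set where
  constructor mkEG
  field
    N : ℕ
    E : List (Fin N × Fin N)

open EGraph

edgesOf : (R : RootedGraph) → List (Fin (suc (n R)) × Fin (suc (n R)))
edgesOf R = concatMap (λ i → concatMap (λ j → if adj R i j then (i , j) ∷ [] else [])
                                        (allFin (suc (n R))))
                      (allFin (suc (n R)))

toEG : RootedGraph → EGraph
toEG R = mkEG (suc (n R)) (edgesOf R)

record Ext (G : EGraph) : Set where
  constructor ext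
  field
    G'  : EGraph
    emb : Fin (N G) → Fin (N G')
    pt  : Fin (N G')

open Ext

mapPair : ∀ {a b} → (Fin a → Fin b) → Fin a × Fin a → Fin b × Fin b
mapPair f (x , y) = f x , f y

addVertex : (G : EGraph) → Fin (N G) → EGraph
addVertex (mkEG N E) w = mkEG (suc N) ((inject₁ w , fromℕ N) ∷ map (mapPair inject₁) E)

addPath : (G : EGraph) → Fin (N G) → ℕ → Ext G
addPath G w zero = ext G (λ x → x) w
addPath G w (suc k) with addPath (addVertex G w) (fromℕ (N G)) k
... | ext G' e p = ext G' (λ x → e (inject₁ x)) p

embedR : (G : EGraph) → Fin (N G) → (R : RootedGraph) → Fin (suc (n R)) → Fin (N G + n R)
embedR G w R j with root R ≟F j
... | yes _ = w ↑ˡ n R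
... | no ne = N G ↑ʳ punchOut ne

attach : (G : EGraph) → Fin (N G) → RootedGraph → Ext G
attach G w R = ext (mkEG (N G + n R) (map (mapPair (_↑ˡ n R)) (E G)
                                      ++ map (mapPair (embedR G w R)) (edgesOf R)))
                   (_↑ˡ n R) (w ↑ˡ n R)

P : ℕ → RootedGraph → RootedGraph → EGraph
P k G H with addPath (toEG G) (root G) k
... | ext G1 _ e = G' (attach G1 e H)

K1 : RootedGraph
K1 = record { n = 0 ; adj = λ _ _ → false ; adj-sym = λ _ _ → refl
            ; adj-irrefl = λ _ → refl ; root = zero }

tailG : RootedGraph → ℕ → EGraph
tailG G k = P k G K1

neq : ∀ {m} → Fin m → Fin m → Bool
neq i j = not ⌊ i ≟F j ⌋

neq-sym : ∀ {m} (i j : Fin m) → neq i j ≡ neq j i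
neq-sym i j with i ≟F j | j ≟F i
... | yes _ | yes _ = refl
... | no _  | no _  = refl
... | yes p | no q  with q (sym p)
...   | ()
neq-sym i j | no p | yes q with p (sym q)
...   | ()

neq-irrefl : ∀ {m} (i : Fin m) → neq i i ≡ false
neq-irrefl i with i ≟F i
... | yes _ = refl
... | no p with p refl
...   | ()

-- K m = complete graph K_m (for m ≥ 1; vertex set Fin (suc (m ∸ 1)))
K : ℕ → RootedGraph
K m = record { n = m ∸ 1 ; adj = neq ; adj-sym = neq-sym
             ; adj-irrefl = neq-irrefl ; root = zero }

lollipop : ℕ → ℕ → EGraph
lollipop m z = tailG (K m) z

spider : ℕ → ℕ → ℕ → RootedGraph → RootedGraph → RootedGraph → EGraph
spider t1 t2 t3 G1 G2 G3 =
  let C  = mkEG 1 []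
      c  = zero
      e1 = addPath C c t1
      a1 = attach (G' e1) (pt e1) G1
      c1 = emb a1 (emb e1 c)
      e2 = addPath (G' a1) c1 t2
      a2 = attach (G' e2) (pt e2) G2
      c2 = emb a2 (emb e2 c1)
      e3 = addPath (G' a2) c2 t3
      a3 = attach (G' e3) (pt e3) G3
  in G' a3

-- Symmetric functions with integer coefficients, represented by their
-- coefficient function on monomials x_1^{α_1} ... x_L^{α_L} (α : List ℕ,
-- trailing variables have exponent 0).

Mono : Set
Mono = List ℕ

SF : Set
SF = Mono → ℤ

infix 4 _≈_
_≈_ : SF → SF → Set
f ≈ g = ∀ α → f α ≡ g α

infixl 6 _⊕_ _⊖_
infixl 7 _⊛_ _·_

_⊕_ : SF → SF → SF
(f ⊕ g) α = f α ℤ.+ g α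

_⊖_ : SF → SF → SF
(f ⊖ g) α = f α ℤ.- g α

_·_ : ℤ → SF → SF
(c · f) α = c ℤ.* f α

allB : ∀ {A : Set} → (A → Bool) → List A → Bool
allB p = foldr (λ x b → p x ∧ b) true

sumℕ : List ℕ → ℕ
sumℕ = foldr _+_ 0

sumℤ : List ℤ → ℤ
sumℤ = foldr ℤ._+_ (+ 0)

zeroSF : SF
zeroSF _ = + 0

sumSF : List SF → SF
sumSF = foldr _⊕_ zeroSF

subMonos : Mono → List Mono
subMonos [] = [] ∷ []
subMonos (a ∷ α) = concatMap (λ b → map (b ∷_) (subMonos α)) (upTo (suc a))

_⊛_ : SF → SF → SF
(f ⊛ g) α = sumℤ (map (λ β → f β ℤ.* g (zipWith _∸_ α β)) (subMonos α))

e : ℕ → SF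
e a α = if allB (λ x → x ≤ᵇ 1) α ∧ (sumℕ α ≡ᵇ a) then + 1 else + 0

countB : ∀ {A : Set} → (A → Bool) → List A → ℕ
countB p [] = 0
countB p (x ∷ xs) = if p x then suc (countB p xs) else countB p xs

consF : ∀ {N L} → Fin L → (Fin N → Fin L) → Fin (suc N) → Fin L
consF c f zero = c
consF c f (suc i) = f i

allFuns : (N L : ℕ) → List (Fin N → Fin L)
allFuns zero L = (λ ()) ∷ []
allFuns (suc N) L = concatMap (λ c → map (consF c) (allFuns N L)) (allFin L)

proper : ∀ {N L} → List (Fin N × Fin N) → (Fin N → Fin L) → Bool
proper E κ = allB (λ xy → not ⌊ κ (proj₁ xy) ≟F κ (proj₂ xy) ⌋) E

hasContent : ∀ {N} (α : Mono) → (Fin N → Fin (length α)) → Bool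
hasContent {N} α κ =
  allB (λ i → countB (λ x → ⌊ κ x ≟F i ⌋) (allFin N) ≡ᵇ List.lookup α i) (allFin (length α))

X : EGraph → SF
X (mkEG N E) α = + countB (λ κ → proper E κ ∧ hasContent α κ) (allFuns N (length α))

-- index set {(a,b,c) : a+b+c = k+m-2, a,b,c ≥ 0, a ≤ m-1}
-- (the equation is read over ℤ: written as a+b+c+2 = k+m)
triples : ℕ → ℕ → List (ℕ × ℕ × ℕ)
triples k m =
  concatMap (λ a → concatMap (λ b → concatMap (λ c →
      if (a + b + c + 2) ≡ᵇ (k + m) then (a , b , c) ∷ [] else [])
    (upTo (k + m))) (upTo (k + m))) (upTo m)

{-# OPTIONS --safe #-}
-- Fix the number L of variables.  For a rooted graph R let R⁻(c) be the generating function of the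
-- colourings of R with root colour c, the weight x_c of the root being left out.  With
-- (B f)(i) = Σ_{j ≠ i} x_j f(j), ⟨f , g⟩ = Σ x_i f(i) g(i) and s(f) = ⟨f , 1⟩, transfer matrices give
--   X_{P^k(G,H)} = ⟨B^k G⁻ , H⁻⟩,  X_{G^k} = s(B^k G⁻),  X_S = Σ_i x_i (B^g G⁻)(i) (B^h H⁻)(i) (B^k K_m⁻)(i),
-- and K_m⁻ = (m-1)! E_{m-1}, where E_n(i) = e_n of the variables other than x_i.  As B f = s(f) - x f,
-- and as E_{n+1} = e_{n+1} - x E_n, multiplication by x on the third leg can be traded for
-- s - B on the first; doing this k times with B and then m-1 times with E proves the formula.
-- The products of tails are collected by E_{n+1} = B E_n - n e_{n+1}, which turns ⟨f , E_n⟩ into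
-- Σ_a (1 - a) e_a s(B^{n-a} f).
module Submission where

open import Algebra.Bundles using (CommutativeRing)
import Algebra.Construct.Pointwise as Pointwise
import Algebra.Properties.AbelianGroup
import Algebra.Properties.Ring
import Algebra.Properties.Semiring.Mult
import Algebra.Properties.Semiring.Sum
import Algebra.Solver.Ring.NaturalCoefficients.Default
open import Data.Bool using (Bool; true; false; not; _∧_; if_then_else_)
open import Data.Bool.Properties using (∧-assoc; ∧-identityʳ; ∧-zeroʳ; ⇔→≡)
open import Data.Empty using (⊥-elim)
open import Data.Fin using (Fin; zero; suc; toℕ; inject₁; fromℕ; _↑ˡ_; _↑ʳ_; punchOut)
open import Data.Fin.Properties using (toℕ<n) renaming (_≟_ to _≟F_)
open import Data.Integer as ℤ using (ℤ; +_)
import Data.Integer.Properties as ℤₚ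
open import Data.List using (List; []; _∷_; _++_; map; concatMap; allFin; tabulate; length; lookup; upTo; applyUpTo; zipWith)
open import Data.List.Properties using (map-∘; map-++; map-cong)
open import Data.Nat as ℕ using (ℕ; zero; suc; _∸_; _≡ᵇ_; _≤_; _<_; s≤s; _!)
import Data.Nat.Properties as ℕₚ
open import Data.Nat.Tactic.RingSolver using (solve-∀)
open import Data.Product using (_×_; _,_; proj₁; proj₂)
open import Data.Vec using (Vec; []; _∷_; toList)
open import Function using (_∘_; id)
open import Function.Bundles using (mk⇔)
open import Level using (0ℓ)
open import Relation.Binary.PropositionalEquality as ≡ using (_≡_; _≢_; _≗_)
import Relation.Binary.Reasoning.Setoid
open import Relation.Nullary using (yes; no)
open import Relation.Nullary.Decidable using (⌊_⌋; isYes≗does)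

open import Defs hiding (_≈_)

-- Power series and elementary symmetric polynomials

-- Leaving out the root weight makes gluing a pointwise product: the shared vertex receives its
-- factor `x i` exactly once, inside `total`. The transfer and colouring arguments live over an
-- arbitrary commutative ring with arbitrary elements `x i`. The theorem is an equation between
-- coefficients at an exponent list α, so it suffices to specialise to power series in `length α`
-- variables, where operations on coefficient functions become ring operations. In an arbitrary ring
-- (m-1)! cannot be divided out, so it stays a scalar in front of the spider and of each lollipop.
-- Differences are the other obstacle: the solver knows only commutative semirings, so B f = s(f) -
-- x f and its relatives are kept as sums, with the negative term moved across and cancelled later.
-- Both trades are one lemma, because the pairs (`E (suc n)`, `E n`) and (`B u`, `u`) each satisfy v
-- + x u = constant. Every trade sheds a product s(f) ⟨g , u⟩; these are the products of tails.

neq-suc : ∀ {m} (i j : Fin m) → neq (suc i) (suc j) ≡ neq i j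
neq-suc i j = ≡.cong not (≡.trans (isYes≗does (suc i ≟F suc j)) (≡.sym (isYes≗does (i ≟F j))))

module Convolution (R : CommutativeRing 0ℓ 0ℓ) where
  open CommutativeRing R hiding (zero)
  open Algebra.Solver.Ring.NaturalCoefficients.Default commutativeSemiring
    using (solve; _:=_; _:+_; _:*_)
  open Relation.Binary.Reasoning.Setoid setoid

  infixl 7 _⋆_
  -- The Cauchy product, by recursion on the shift of the first factor; this lets the ring laws go
  -- by induction on the degree without index arithmetic.
  _⋆_ : (ℕ → Carrier) → (ℕ → Carrier) → ℕ → Carrier
  (f ⋆ g) zero    = f 0 * g 0
  (f ⋆ g) (suc n) = f 0 * g (suc n) + ((f ∘ suc) ⋆ g) n

  -- Multiplication by the series variable. It also expresses convolutions that are empty in degree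
  -- 0, which avoids truncated predecessors.
  delay : (ℕ → Carrier) → ℕ → Carrier
  delay f zero    = 0#
  delay f (suc n) = f n

  ⋆-cong : ∀ {f f′ g g′} → (∀ n → f n ≈ f′ n) → (∀ n → g n ≈ g′ n) →
           ∀ n → (f ⋆ g) n ≈ (f′ ⋆ g′) n
  ⋆-cong p q zero    = *-cong (p 0) (q 0)
  ⋆-cong p q (suc n) = +-cong (*-cong (p 0) (q (suc n))) (⋆-cong (p ∘ suc) q n)

  -- The definition peels off the term with index 0 in `f`; commutativity needs the opposite end as
  -- well.
  ⋆-last : ∀ f g n → (f ⋆ g) (suc n) ≈ (f ⋆ (g ∘ suc)) n + f (suc n) * g 0
  ⋆-last f g zero    = refl
  ⋆-last f g (suc n) = trans (+-congˡ (⋆-last (f ∘ suc) g n)) (sym (+-assoc _ _ _))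

  ⋆-comm : ∀ f g n → (f ⋆ g) n ≈ (g ⋆ f) n
  ⋆-comm f g zero    = *-comm _ _
  ⋆-comm f g (suc n) = begin
    f 0 * g (suc n) + ((f ∘ suc) ⋆ g) n  ≈⟨ +-cong (*-comm _ _) (⋆-comm (f ∘ suc) g n) ⟩
    g (suc n) * f 0 + (g ⋆ (f ∘ suc)) n  ≈⟨ +-comm _ _ ⟩
    (g ⋆ (f ∘ suc)) n + g (suc n) * f 0  ≈⟨ ⋆-last g f n ⟨
    (g ⋆ f) (suc n)                      ∎

  ⋆-distribʳ : ∀ h f g n → ((λ k → f k + g k) ⋆ h) n ≈ (f ⋆ h) n + (g ⋆ h) n
  ⋆-distribʳ h f g zero    = distribʳ _ _ _
  ⋆-distribʳ h f g (suc n) = trans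
    (+-congˡ (⋆-distribʳ h (f ∘ suc) (g ∘ suc) n))
    (solve 5 (λ a b c d e → (a :+ b) :* c :+ (d :+ e) := (a :* c :+ d) :+ (b :* c :+ e)) refl _ _ _ _ _)

  ⋆-distribˡ : ∀ h f g n → (h ⋆ (λ k → f k + g k)) n ≈ (h ⋆ f) n + (h ⋆ g) n
  ⋆-distribˡ h f g n = trans (⋆-comm h _ n)
    (trans (⋆-distribʳ h f g n) (+-cong (⋆-comm f h n) (⋆-comm g h n)))

  ⋆-scaleˡ : ∀ c f g n → ((λ k → c * f k) ⋆ g) n ≈ c * (f ⋆ g) n
  ⋆-scaleˡ c f g zero    = *-assoc _ _ _
  ⋆-scaleˡ c f g (suc n) = trans (+-cong (*-assoc _ _ _) (⋆-scaleˡ c (f ∘ suc) g n)) (sym (distribˡ _ _ _))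

  ⋆-scaleʳ : ∀ c f g n → (f ⋆ (λ k → c * g k)) n ≈ c * (f ⋆ g) n
  ⋆-scaleʳ c f g n = trans (⋆-comm f _ n) (trans (⋆-scaleˡ c g f n) (*-congˡ (⋆-comm g f n)))

  ⋆-assoc : ∀ f g h n → ((f ⋆ g) ⋆ h) n ≈ (f ⋆ (g ⋆ h)) n
  ⋆-assoc f g h zero    = *-assoc _ _ _
  ⋆-assoc f g h (suc n) = begin
    f 0 * g 0 * h (suc n) + (((f ⋆ g) ∘ suc) ⋆ h) n
      ≈⟨ +-congˡ (⋆-distribʳ h (λ k → f 0 * g (suc k)) ((f ∘ suc) ⋆ g) n) ⟩
    f 0 * g 0 * h (suc n) + (((λ k → f 0 * g (suc k)) ⋆ h) n + (((f ∘ suc) ⋆ g) ⋆ h) n)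
      ≈⟨ +-congˡ (+-cong (⋆-scaleˡ (f 0) (g ∘ suc) h n) (⋆-assoc (f ∘ suc) g h n)) ⟩
    f 0 * g 0 * h (suc n) + (f 0 * ((g ∘ suc) ⋆ h) n + ((f ∘ suc) ⋆ (g ⋆ h)) n)
      ≈⟨ solve 5 (λ a b c d e → a :* b :* c :+ (a :* d :+ e) := a :* (b :* c :+ d) :+ e) refl _ _ _ _ _ ⟩
    (f ⋆ (g ⋆ h)) (suc n) ∎

  ⋆-zeroˡ : ∀ {f} → (∀ k → f k ≈ 0#) → ∀ g n → (f ⋆ g) n ≈ 0#
  ⋆-zeroˡ p g zero    = trans (*-congʳ (p 0)) (zeroˡ _)
  ⋆-zeroˡ p g (suc n) = trans (+-cong (trans (*-congʳ (p 0)) (zeroˡ _)) (⋆-zeroˡ (p ∘ suc) g n)) (+-identityˡ _)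

  constant : Carrier → ℕ → Carrier
  constant c zero    = c
  constant c (suc _) = 0#

  constant-⋆ : ∀ c g n → (constant c ⋆ g) n ≈ c * g n
  constant-⋆ c g zero    = refl
  constant-⋆ c g (suc n) = trans (+-congˡ (⋆-zeroˡ (λ _ → refl) g n)) (+-identityʳ _)

  ⋆-delay : ∀ f g n → (f ⋆ g) n ≈ delay (f ⋆ (g ∘ suc)) n + f n * g 0
  ⋆-delay f g zero    = sym (+-identityˡ _)
  ⋆-delay f g (suc n) = ⋆-last f g n

  delay-cong : ∀ {f g} → (∀ n → f n ≈ g n) → ∀ n → delay f n ≈ delay g n
  delay-cong p zero    = refl
  delay-cong p (suc n) = p n

  ⋆-unfold : ∀ f g n → (f ⋆ g) n ≈ f 0 * g n + delay ((f ∘ suc) ⋆ g) n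
  ⋆-unfold f g zero    = sym (+-identityʳ _)
  ⋆-unfold f g (suc n) = refl

powerSeriesRing : CommutativeRing 0ℓ 0ℓ → CommutativeRing 0ℓ 0ℓ
powerSeriesRing R = record
  { Carrier = ℕ → Carrier
  ; _≈_ = λ f g → ∀ n → f n ≈ g n
  ; _+_ = λ f g n → f n + g n
  ; _*_ = _⋆_
  ; -_  = λ f n → - f n
  ; 0#  = λ _ → 0#
  ; 1#  = constant 1#
  ; isCommutativeRing = record
    { isRing = record
      { +-isAbelianGroup = Pointwise.isAbelianGroup ℕ +-isAbelianGroup
      ; *-cong = ⋆-cong
      ; *-assoc = ⋆-assoc
      ; *-identity = identityˡ , λ f n → trans (⋆-comm f _ n) (identityˡ f n)
      ; distrib = ⋆-distribˡ , ⋆-distribʳ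
      }
    ; *-comm = ⋆-comm
    }
  }
  where
  open CommutativeRing R hiding (zero)
  open Convolution R
  identityˡ : ∀ f n → (constant 1# ⋆ f) n ≈ f n
  identityˡ f n = trans (constant-⋆ 1# f n) (*-identityˡ _)

-- Elementary symmetric polynomials with one variable omitted

module Elementary (R : CommutativeRing 0ℓ 0ℓ) where
  open CommutativeRing R hiding (zero)
  open Algebra.Properties.Semiring.Sum semiring using (sum; sum-cong-≋; ∑-distrib-+; *-distribˡ-sum)
  open Algebra.Properties.Semiring.Mult semiring using (×-comm-*) renaming (_×_ to _⊠_)
  open Algebra.Solver.Ring.NaturalCoefficients.Default commutativeSemiring
    using (solve; _:=_; _:+_; _:*_; con)
  open Relation.Binary.Reasoning.Setoid setoid

  ⟦_⟧ : Bool → Carrier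
  ⟦ b ⟧ = if b then 1# else 0#

  ⟦∧⟧ : ∀ b c → ⟦ b ∧ c ⟧ ≈ ⟦ b ⟧ * ⟦ c ⟧
  ⟦∧⟧ true  c = sym (*-identityˡ _)
  ⟦∧⟧ false c = sym (zeroˡ _)

  ⟦⟧-cong : ∀ {b c} → b ≡ c → ⟦ b ⟧ ≈ ⟦ c ⟧
  ⟦⟧-cong ≡.refl = refl

  -- The variable is set to zero rather than removed, so the index type stays `Fin L` and no
  -- reindexing of the remaining variables is needed.
  omit : ∀ {L} → Fin L → (Fin L → Carrier) → Fin L → Carrier
  omit i y j = ⟦ neq i j ⟧ * y j

  omit-suc : ∀ {L} i (y : Fin (suc L) → Carrier) j → omit (suc i) y (suc j) ≈ omit i (y ∘ suc) j
  omit-suc i y j = *-congʳ (⟦⟧-cong (neq-suc i j))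

  sum-omit : ∀ {L} i (y : Fin L → Carrier) → sum (omit i y) + y i ≈ sum y
  sum-omit {suc L} zero    y = begin
    0# * y zero + sum (λ j → 1# * y (suc j)) + y zero
      ≈⟨ +-congʳ (+-cong (zeroˡ _) (sum-cong-≋ {L} (λ _ → *-identityˡ _))) ⟩
    0# + sum (y ∘ suc) + y zero  ≈⟨ +-congʳ (+-identityˡ _) ⟩
    sum (y ∘ suc) + y zero       ≈⟨ +-comm _ _ ⟩
    sum y                        ∎
  sum-omit {suc L} (suc i) y = begin
    1# * y zero + sum (λ j → omit (suc i) y (suc j)) + y (suc i)
      ≈⟨ +-congʳ (+-cong (*-identityˡ _) (sum-cong-≋ {L} (omit-suc i y))) ⟩
    y zero + sum (omit i (y ∘ suc)) + y (suc i)    ≈⟨ +-assoc _ _ _ ⟩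
    y zero + (sum (omit i (y ∘ suc)) + y (suc i))  ≈⟨ +-congˡ (sum-omit i (y ∘ suc)) ⟩
    sum y                                          ∎

  el : ∀ {L} → ℕ → (Fin L → Carrier) → Carrier
  el         zero    y = 1#
  el {zero}  (suc a) y = 0#
  el {suc L} (suc a) y = el (suc a) (y ∘ suc) + y zero * el a (y ∘ suc)

  el-cong : ∀ {L} a {y z : Fin L → Carrier} → (∀ i → y i ≈ z i) → el a y ≈ el a z
  el-cong         zero    p = refl
  el-cong {zero}  (suc a) p = refl
  el-cong {suc L} (suc a) p = +-cong (el-cong (suc a) (p ∘ suc)) (*-cong (p zero) (el-cong a (p ∘ suc)))

  el-omit-zero : ∀ {L} a (y : Fin (suc L) → Carrier) → el a (omit zero y) ≈ el a (y ∘ suc)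
  el-omit-zero zero    y = refl
  el-omit-zero {L} (suc a) y = begin
    el (suc a) (λ j → 1# * y (suc j)) + 0# * y zero * el a (λ j → 1# * y (suc j))
      ≈⟨ solve 3 (λ p q r → p :+ con 0 :* q :* r := p) refl _ _ _ ⟩
    el (suc a) (λ j → 1# * y (suc j))  ≈⟨ el-cong {L} (suc a) (λ _ → *-identityˡ _) ⟩
    el (suc a) (y ∘ suc)               ∎

  el-omit-suc : ∀ {L} a i (y : Fin (suc L) → Carrier) →
                el (suc a) (omit (suc i) y) ≈ el (suc a) (omit i (y ∘ suc)) + y zero * el a (omit i (y ∘ suc))
  el-omit-suc a i y = +-cong (el-cong (suc a) (omit-suc i y)) (*-cong (*-identityˡ _) (el-cong a (omit-suc i y)))

  -- The recursion of `el` singles out the first variable only; by induction the same splitting, by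
  -- whether a variable occurs, holds at any position.
  el-split : ∀ {L} a i (y : Fin L → Carrier) →
             el (suc a) y ≈ el (suc a) (omit i y) + y i * el a (omit i y)
  el-split {suc L} a zero y = sym (+-cong (el-omit-zero (suc a) y) (*-congˡ (el-omit-zero a y)))
  -- Degree one is separate because `el 0` is the constant `1#` and offers no recursion to unfold.
  el-split {suc L} zero (suc i) y = begin
    el 1 (y ∘ suc) + y zero * 1#
      ≈⟨ +-congʳ (el-split 0 i (y ∘ suc)) ⟩
    el 1 (omit i (y ∘ suc)) + y (suc i) * 1# + y zero * 1#
      ≈⟨ solve 3 (λ p q r → p :+ q :+ r := p :+ r :+ q) refl _ _ _ ⟩
    el 1 (omit i (y ∘ suc)) + y zero * 1# + y (suc i) * 1#
      ≈⟨ +-congʳ (el-omit-suc 0 i y) ⟨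
    el 1 (omit (suc i) y) + y (suc i) * 1# ∎
  el-split {suc L} (suc a) (suc i) y = begin
    el (suc (suc a)) (y ∘ suc) + y zero * el (suc a) (y ∘ suc)
      ≈⟨ +-cong (el-split (suc a) i (y ∘ suc)) (*-congˡ (el-split a i (y ∘ suc))) ⟩
    (E (suc (suc a)) + y (suc i) * E (suc a)) + y zero * (E (suc a) + y (suc i) * E a)
      ≈⟨ solve 5 (λ p q r s t → (p :+ q :* r) :+ s :* (r :+ q :* t) := (p :+ s :* r) :+ q :* (r :+ s :* t)) refl _ _ _ _ _ ⟩
    (E (suc (suc a)) + y zero * E (suc a)) + y (suc i) * (E (suc a) + y zero * E a)
      ≈⟨ +-cong (el-omit-suc (suc a) i y) (*-congˡ (el-omit-suc a i y)) ⟨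
    el (suc (suc a)) (omit (suc i) y) + y (suc i) * el (suc a) (omit (suc i) y) ∎
    where E = λ b → el b (omit i (y ∘ suc))

  -- Double counting: each squarefree monomial of degree `suc a` arises once for each of its `suc a`
  -- variables.
  sum-el-omit : ∀ {L} a (y : Fin L → Carrier) →
                sum (λ i → y i * el a (omit i y)) ≈ suc a ⊠ el (suc a) y
  sum-el-omit {zero} a y = sym (zeros (suc a))
    where
    zeros : ∀ m → m ⊠ 0# ≈ 0#
    zeros zero    = refl
    zeros (suc m) = trans (+-identityˡ _) (zeros m)
  sum-el-omit {suc L} zero y = begin
    y zero * 1# + sum (λ i → y (suc i) * 1#)  ≈⟨ +-congˡ (sum-el-omit 0 (y ∘ suc)) ⟩
    y zero * 1# + (el 1 (y ∘ suc) + 0#)       ≈⟨ solve 2 (λ p q → p :+ (q :+ con 0) := (q :+ p) :+ con 0) refl _ _ ⟩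
    1 ⊠ el 1 y                                ∎
  sum-el-omit {suc L} (suc a) y = begin
    y zero * el (suc a) (omit zero y) + sum (λ i → y (suc i) * el (suc a) (omit (suc i) y))
      ≈⟨ +-cong (*-congˡ (el-omit-zero (suc a) y)) (sum-cong-≋ {L} tail-terms) ⟩
    y zero * el (suc a) (y ∘ suc) + sum (λ i → y (suc i) * E (suc a) i + y zero * (y (suc i) * E a i))
      ≈⟨ +-congˡ (trans (∑-distrib-+ (λ i → y (suc i) * E (suc a) i) (λ i → y zero * (y (suc i) * E a i))) (+-cong (sum-el-omit (suc a) (y ∘ suc))
           (trans (sym (*-distribˡ-sum (y zero) (λ i → y (suc i) * E a i))) (*-congˡ (sum-el-omit a (y ∘ suc)))))) ⟩
    y zero * el (suc a) (y ∘ suc) + (suc (suc a) ⊠ el (suc (suc a)) (y ∘ suc) + y zero * (suc a ⊠ el (suc a) (y ∘ suc)))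
      ≈⟨ +-congˡ (+-congˡ (×-comm-* (suc a) _ _)) ⟩
    y zero * el (suc a) (y ∘ suc) + (suc (suc a) ⊠ el (suc (suc a)) (y ∘ suc) + suc a ⊠ (y zero * el (suc a) (y ∘ suc)))
      -- The term that singles out the first variable joins the other `suc a` copies, so both
      -- multiplicities become `suc (suc a)`.
      ≈⟨ solve 3 (λ p q r → p :+ (q :+ r) := q :+ (p :+ r)) refl _ _ _ ⟩
    suc (suc a) ⊠ el (suc (suc a)) (y ∘ suc) + suc (suc a) ⊠ (y zero * el (suc a) (y ∘ suc))
      ≈⟨ ×-distrib (suc (suc a)) _ _ ⟨
    suc (suc a) ⊠ el (suc (suc a)) y ∎
    where
    E : ℕ → Fin L → Carrier
    E b i = el b (omit i (y ∘ suc))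
    tail-terms : ∀ i → y (suc i) * el (suc a) (omit (suc i) y) ≈ y (suc i) * E (suc a) i + y zero * (y (suc i) * E a i)
    tail-terms i = trans (*-congˡ (el-omit-suc a i y))
      (solve 4 (λ p q r s → p :* (q :+ r :* s) := p :* q :+ r :* (p :* s)) refl _ _ _ _)
    ×-distrib : ∀ n p q → n ⊠ (p + q) ≈ n ⊠ p + n ⊠ q
    ×-distrib zero    p q = sym (+-identityˡ _)
    ×-distrib (suc n) p q = trans (+-congˡ (×-distrib n p q))
      (solve 4 (λ p q r s → (p :+ q) :+ (r :+ s) := (p :+ r) :+ (q :+ s)) refl _ _ _ _)

-- The transfer operator

module Transfer (R : CommutativeRing 0ℓ 0ℓ) {L : ℕ} (x : Fin L → CommutativeRing.Carrier R) where
  open CommutativeRing R hiding (zero)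
  open Convolution R
  open Elementary R
  open Algebra.Properties.Semiring.Sum semiring using (sum; sum-cong-≋; ∑-distrib-+; *-distribˡ-sum)
  open Algebra.Properties.Semiring.Mult semiring using () renaming (_×_ to _⊠_)
  open Algebra.Properties.AbelianGroup +-abelianGroup using (∙-cancelʳ; xyx⁻¹≈y)
  open Algebra.Solver.Ring.NaturalCoefficients.Default commutativeSemiring
    using (solve; _:=_; _:+_; _:*_; con)
  open Relation.Binary.Reasoning.Setoid setoid

  Fun : Set
  Fun = Fin L → Carrier

  infix 4 _≋_
  _≋_ : Fun → Fun → Set
  f ≋ g = ∀ i → f i ≈ g i

  B : Fun → Fun
  B f i = sum (omit i (λ j → x j * f j))

  B^ : ℕ → Fun → Fun
  B^ zero    f = f
  B^ (suc k) f = B (B^ k f)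

  total : Fun → Carrier
  total f = sum (λ i → x i * f i)

  -- The weight hidden in `total` is that of the glued vertex, absent from both arguments; the same
  -- holds for `triple`.
  pair : Fun → Fun → Carrier
  pair f g = total (λ i → f i * g i)

  triple : Fun → Fun → Fun → Carrier
  triple f g h = total (λ i → f i * g i * h i)

  E : ℕ → Fun
  E n i = el n (omit i x)

  eₓ : ℕ → Carrier
  eₓ n = el n x

  B-cong : ∀ {f g} → f ≋ g → B f ≋ B g
  B-cong p i = sum-cong-≋ {L} (λ j → *-congˡ (*-congˡ (p j)))

  B^-cong : ∀ k {f g} → f ≋ g → B^ k f ≋ B^ k g
  B^-cong zero    p = p
  B^-cong (suc k) p = B-cong (B^-cong k p)

  total-cong : ∀ {f g} → f ≋ g → total f ≈ total g
  total-cong p = sum-cong-≋ {L} (λ i → *-congˡ (p i))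

  B^-+ : ∀ j k f → B^ (j ℕ.+ k) f ≡ B^ j (B^ k f)
  B^-+ zero    k f = ≡.refl
  B^-+ (suc j) k f = ≡.cong B (B^-+ j k f)

  B^-suc : ∀ k f → B^ k (B f) ≡ B^ (suc k) f
  B^-suc zero    f = ≡.refl
  B^-suc (suc k) f = ≡.cong B (B^-suc k f)

  B-total : ∀ f i → B f i + x i * f i ≈ total f
  B-total f i = sum-omit i (λ j → x j * f j)

  total-+ : ∀ f g → total f + total g ≈ total (λ i → f i + g i)
  total-+ f g = sym (trans (sum-cong-≋ {L} (λ _ → distribˡ _ _ _)) (∑-distrib-+ (λ i → x i * f i) _))

  total-scale : ∀ c f → total (λ i → c * f i) ≈ c * total f
  total-scale c f = trans (sum-cong-≋ {L} (λ i → solve 3 (λ x c f → x :* (c :* f) := c :* (x :* f)) refl (x i) c (f i)))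
                          (sym (*-distribˡ-sum c (λ i → x i * f i)))

  total-+-scale : ∀ c {f g h} → (∀ i → f i + g i ≈ c * h i) → total f + total g ≈ c * total h
  total-+-scale c {f} {g} {h} p = trans (total-+ f g) (trans (total-cong p) (total-scale c h))

  B-scale : ∀ c f → B (λ i → c * f i) ≋ (λ i → c * B f i)
  B-scale c f i = trans
    (sum-cong-≋ {L} (λ j → solve 4 (λ n x c f → n :* (x :* (c :* f)) := c :* (n :* (x :* f))) refl ⟦ neq i j ⟧ (x j) c (f j)))
    (sym (*-distribˡ-sum c (omit i (λ j → x j * f j))))

  B^-scale : ∀ k c f → B^ k (λ i → c * f i) ≋ (λ i → c * B^ k f i)
  B^-scale zero    c f i = refl
  B^-scale (suc k) c f i = trans (B-cong (B^-scale k c f) i) (B-scale c (B^ k f) i)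

  -- `B` is the rank-one operator given by `total` minus the diagonal operator `x`. Adding the
  -- diagonal term, which is symmetric in `f` and `g`, turns either side into `total f * total g`.
  B-selfAdjoint : ∀ f g → pair (B f) g ≈ pair f (B g)
  B-selfAdjoint f g = ∙-cancelʳ (total (λ i → x i * (f i * g i))) _ _ (begin
    pair (B f) g + total (λ i → x i * (f i * g i))
      ≈⟨ total-+-scale (total f) (λ i → trans
           (solve 4 (λ b g x f → b :* g :+ x :* (f :* g) := (b :+ x :* f) :* g) refl (B f i) (g i) (x i) (f i))
           (*-congʳ (B-total f i))) ⟩
    total f * total g  ≈⟨ *-comm _ _ ⟩
    total g * total f
      ≈⟨ total-+-scale (total g) (λ i → trans
           (solve 4 (λ b g x f → f :* b :+ x :* (f :* g) := (b :+ x :* g) :* f) refl (B g i) (g i) (x i) (f i))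
           (*-congʳ (B-total g i))) ⟨
    pair f (B g) + total (λ i → x i * (f i * g i)) ∎)

  B^-selfAdjoint : ∀ k f g → pair (B^ k f) g ≈ pair f (B^ k g)
  B^-selfAdjoint zero    f g = refl
  B^-selfAdjoint (suc k) f g = begin
    pair (B (B^ k f)) g  ≈⟨ B-selfAdjoint (B^ k f) g ⟩
    pair (B^ k f) (B g)  ≈⟨ B^-selfAdjoint k f (B g) ⟩
    pair f (B^ k (B g))  ≡⟨ ≡.cong (pair f) (B^-suc k g) ⟩
    pair f (B^ (suc k) g) ∎

  -- Both sides rewrite total (x f g u): x u = c - v on the third leg, x f = total f - B f on the first.
  triple-exchange : ∀ c {u v} → (∀ i → v i + x i * u i ≈ c) → ∀ f g →
                    triple f g v + total f * pair g u ≈ c * pair f g + triple (B f) g u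
  triple-exchange c {u} {v} p f g = begin
    triple f g v + total f * pair g u
      ≈⟨ +-congˡ (total-+-scale (total f) (λ i → trans
           (solve 5 (λ b g u x f → b :* g :* u :+ x :* (f :* g :* u) := (b :+ x :* f) :* (g :* u)) refl (B f i) (g i) (u i) (x i) (f i))
           (*-congʳ (B-total f i)))) ⟨
    triple f g v + (triple (B f) g u + shared)
      ≈⟨ solve 3 (λ p q r → p :+ (q :+ r) := p :+ r :+ q) refl _ _ _ ⟩
    triple f g v + shared + triple (B f) g u
      ≈⟨ +-congʳ (total-+-scale c (λ i → trans
           (solve 5 (λ v g u x f → f :* g :* v :+ x :* (f :* g :* u) := (v :+ x :* u) :* (f :* g)) refl (v i) (g i) (u i) (x i) (f i))
           (*-congʳ (p i)))) ⟩
    c * pair f g + triple (B f) g u ∎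
    where shared = total (λ i → x i * (f i * g i * u i))

  E-suc : ∀ n i → E (suc n) i + x i * E n i ≈ eₓ (suc n)
  E-suc n i = sym (el-split n i x)

  d : ℕ → Carrier
  d a = eₓ a - a ⊠ eₓ a

  -- Two evaluations of x E_n are compared: e_{n+1} - E_{n+1}, and s(E_n) - B E_n with s(E_n) =
  -- (n+1) e_{n+1} by `sum-el-omit`. This is the origin of the factor 1 - a in `d`.
  E-B : ∀ n i → E (suc n) i ≈ B (E n) i + d (suc n)
  E-B n i = begin
    E (suc n) i
      ≈⟨ xyx⁻¹≈y m (E (suc n) i) ⟨
    m + E (suc n) i - m
      ≈⟨ +-congʳ (∙-cancelʳ (x i * E n i) _ _ (begin
           m + E (suc n) i + x i * E n i            ≈⟨ +-assoc _ _ _ ⟩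
           m + (E (suc n) i + x i * E n i)          ≈⟨ +-cong (sym (trans (B-total (E n) i) (sum-el-omit n x))) (E-suc n i) ⟩
           B (E n) i + x i * E n i + eₓ (suc n)     ≈⟨ solve 3 (λ p q r → p :+ q :+ r := p :+ r :+ q) refl _ _ _ ⟩
           B (E n) i + eₓ (suc n) + x i * E n i     ∎)) ⟩
    B (E n) i + eₓ (suc n) - m  ≈⟨ +-assoc _ _ _ ⟩
    B (E n) i + d (suc n)       ∎
    where m = suc n ⊠ eₓ (suc n)

  -- Convolution identities for pairs and triples

  totals : Fun → ℕ → Carrier
  totals f j = total (B^ j f)

  pairs : Fun → Fun → ℕ → Carrier
  pairs f g j = pair (B^ j f) g

  totals-suc : ∀ f j → totals (B f) j ≈ totals f (suc j)
  totals-suc f j = reflexive (≡.cong total (B^-suc j f))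

  pairs-suc : ∀ f g j → pairs (B f) g j ≈ pairs f g (suc j)
  pairs-suc f g j = reflexive (≡.cong (λ u → pair u g) (B^-suc j f))

  -- By self-adjointness the `B` produced by `E-B` moves over to `f`, so the induction on `n` must
  -- leave `f` free.
  pair-E : ∀ n f → pair f (E n) ≈ (d ⋆ totals f) n
  pair-E zero    f = trans (total-cong (λ _ → trans (*-comm _ _) (*-congʳ (sym d-zero)))) (total-scale (d 0) f)
    where
    d-zero : d 0 ≈ 1#
    d-zero = trans (solve 2 (λ a b → a :+ b := b :+ a) refl 1# (- 0#)) (∙-cancelʳ 0# _ _ (begin
      - 0# + 1# + 0#  ≈⟨ solve 1 (λ a → a :+ con 1 :+ con 0 := con 1 :+ (a :+ con 0)) refl _ ⟩
      1# + (- 0# + 0#) ≈⟨ +-congˡ (-‿inverseˡ 0#) ⟩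
      1# + 0#          ∎))
  pair-E (suc n) f = begin
    pair f (E (suc n))
      ≈⟨ total-cong (λ i → trans (*-congˡ (E-B n i)) (trans (distribˡ _ _ _) (+-congˡ (*-comm _ _)))) ⟩
    total (λ i → f i * B (E n) i + d (suc n) * f i)
      ≈⟨ total-+ (λ i → f i * B (E n) i) (λ i → d (suc n) * f i) ⟨
    pair f (B (E n)) + total (λ i → d (suc n) * f i)
      ≈⟨ +-cong (trans (sym (B-selfAdjoint f (E n))) (pair-E n (B f))) (total-scale (d (suc n)) f) ⟩
    (d ⋆ totals (B f)) n + d (suc n) * totals f 0
      ≈⟨ +-congʳ (⋆-cong {d} (λ _ → refl) (totals-suc f) n) ⟩
    (d ⋆ (totals f ∘ suc)) n + d (suc n) * totals f 0
      ≈⟨ ⋆-last d (totals f) n ⟨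
    (d ⋆ totals f) (suc n) ∎

  pair-B^E : ∀ k n f → pair f (B^ k (E n)) ≈ (d ⋆ (λ j → totals f (k ℕ.+ j))) n
  pair-B^E k n f = trans (sym (B^-selfAdjoint k f (E n))) (trans (pair-E n (B^ k f))
    (⋆-cong {d} (λ _ → refl) (λ j → reflexive (≡.cong total (shift j))) n))
    where
    shift : ∀ j → B^ j (B^ k f) ≡ B^ (k ℕ.+ j) f
    shift j = ≡.trans (≡.sym (B^-+ j k f)) (≡.cong (λ i → B^ i f) (ℕₚ.+-comm j k))

  -- The sum over b + c = j - 1, which is empty for j = 0.
  products : Fun → Fun → ℕ → Carrier
  products f g = delay (totals f ⋆ totals g)

  products-suc : ∀ f g j → products f g (suc j) ≈ total f * totals g j + products (B f) g j
  products-suc f g j = trans (⋆-unfold (totals f) (totals g) j)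
    (+-congˡ (delay-cong (⋆-cong (λ i → sym (totals-suc f i)) (λ _ → refl)) j))

  -- The terms with b = 0 are split off from the products of tails. Convolved with `d` they
  -- recombine, by `pair-B^E`, into precisely the product that one use of `triple-exchange` sheds.
  d⋆products-suc : ∀ k n f g → (d ⋆ (λ j → products f g (suc (k ℕ.+ j)))) n ≈
                   total f * pair g (B^ k (E n)) + (d ⋆ (λ j → products (B f) g (k ℕ.+ j))) n
  d⋆products-suc k n f g = begin
    (d ⋆ (λ j → products f g (suc (k ℕ.+ j)))) n
      ≈⟨ ⋆-cong {d} (λ _ → refl) (λ j → products-suc f g (k ℕ.+ j)) n ⟩
    (d ⋆ (λ j → total f * totals g (k ℕ.+ j) + products (B f) g (k ℕ.+ j))) n
      ≈⟨ ⋆-distribˡ d (λ j → total f * totals g (k ℕ.+ j)) _ n ⟩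
    (d ⋆ (λ j → total f * totals g (k ℕ.+ j))) n + (d ⋆ (λ j → products (B f) g (k ℕ.+ j))) n
      ≈⟨ +-congʳ (trans (⋆-scaleʳ (total f) d _ n) (*-congˡ (sym (pair-B^E k n g)))) ⟩
    total f * pair g (B^ k (E n)) + (d ⋆ (λ j → products (B f) g (k ℕ.+ j))) n ∎

  -- Induction with `f` free, since each exchange lowers the index of `E` and replaces `f` by `B f`.
  -- The constant e_{n+1} of the exchange yields the summand z = 0 of the convolution on the right.
  triple-E : ∀ n f g → triple f g (E n) + (d ⋆ products f g) n ≈ (eₓ ⋆ pairs f g) n
  triple-E zero f g = begin
    triple f g (E 0) + d 0 * 0#  ≈⟨ solve 2 (λ t d → t :+ d :* con 0 := t) refl _ _ ⟩
    triple f g (E 0)             ≈⟨ total-cong (λ _ → *-identityʳ _) ⟩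
    pair f g                     ≈⟨ *-identityˡ _ ⟨
    1# * pair f g                ∎
  triple-E (suc n) f g = begin
    triple f g (E (suc n)) + (d ⋆ products f g) (suc n)
      -- The summand with a = n + 1 vanishes because it carries `products f g 0`, an empty sum.
      ≈⟨ +-congˡ (trans (⋆-last d (products f g) n) (trans (+-congˡ (zeroʳ _)) (trans (+-identityʳ _) (d⋆products-suc 0 n f g)))) ⟩
    triple f g (E (suc n)) + (total f * pair g (E n) + (d ⋆ products (B f) g) n)
      ≈⟨ +-assoc _ _ _ ⟨
    triple f g (E (suc n)) + total f * pair g (E n) + (d ⋆ products (B f) g) n
      ≈⟨ +-congʳ (triple-exchange (eₓ (suc n)) (E-suc n) f g) ⟩
    eₓ (suc n) * pair f g + triple (B f) g (E n) + (d ⋆ products (B f) g) n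
      ≈⟨ +-assoc _ _ _ ⟩
    eₓ (suc n) * pair f g + (triple (B f) g (E n) + (d ⋆ products (B f) g) n)
      ≈⟨ +-congˡ (triple-E n (B f) g) ⟩
    eₓ (suc n) * pair f g + (eₓ ⋆ pairs (B f) g) n
      ≈⟨ +-comm _ _ ⟩
    (eₓ ⋆ pairs (B f) g) n + eₓ (suc n) * pair f g
      ≈⟨ +-congʳ (⋆-cong {eₓ} (λ _ → refl) (pairs-suc f g) n) ⟩
    (eₓ ⋆ (pairs f g ∘ suc)) n + eₓ (suc n) * pair f g
      ≈⟨ ⋆-last eₓ (pairs f g) n ⟨
    (eₓ ⋆ pairs f g) (suc n) ∎

  -- Here the constant of the exchange is `totals (E n) k`, a lollipop up to the factorial, and it
  -- supplies the summand z = k of the last convolution at `suc k`. The hypothesis at `B f` supplies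
  -- the others, and `triple-E` starts the induction.
  triple-B^E : ∀ k n f g →
    triple f g (B^ k (E n)) + (d ⋆ (λ j → products f g (k ℕ.+ j))) n ≈
    (eₓ ⋆ (λ z → pairs f g (k ℕ.+ z))) n + delay (totals (E n) ⋆ pairs f g) k
  triple-B^E zero    n f g = trans (triple-E n f g) (sym (+-identityʳ _))
  triple-B^E (suc k) n f g = begin
    triple f g (B^ (suc k) (E n)) + (d ⋆ (λ j → products f g (suc (k ℕ.+ j)))) n
      ≈⟨ trans (+-congˡ (d⋆products-suc k n f g)) (sym (+-assoc _ _ _)) ⟩
    triple f g (B^ (suc k) (E n)) + total f * pair g (B^ k (E n)) + (d ⋆ (λ j → products (B f) g (k ℕ.+ j))) n
      ≈⟨ +-congʳ (triple-exchange (totals (E n) k) (B-total (B^ k (E n))) f g) ⟩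
    totals (E n) k * pair f g + triple (B f) g (B^ k (E n)) + (d ⋆ (λ j → products (B f) g (k ℕ.+ j))) n
      ≈⟨ trans (+-assoc _ _ _) (+-congˡ (triple-B^E k n (B f) g)) ⟩
    totals (E n) k * pair f g + ((eₓ ⋆ (λ z → pairs (B f) g (k ℕ.+ z))) n + delay (totals (E n) ⋆ pairs (B f) g) k)
      ≈⟨ solve 3 (λ p q r → p :+ (q :+ r) := q :+ (r :+ p)) refl _ _ _ ⟩
    (eₓ ⋆ (λ z → pairs (B f) g (k ℕ.+ z))) n + (delay (totals (E n) ⋆ pairs (B f) g) k + totals (E n) k * pair f g)
      ≈⟨ +-cong (⋆-cong {eₓ} (λ _ → refl) (λ z → pairs-suc f g (k ℕ.+ z)) n)
                (+-congʳ (delay-cong (⋆-cong {totals (E n)} (λ _ → refl) (pairs-suc f g)) k)) ⟩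
    (eₓ ⋆ (λ z → pairs f g (suc k ℕ.+ z))) n + (delay (totals (E n) ⋆ (pairs f g ∘ suc)) k + totals (E n) k * pair f g)
      ≈⟨ +-congˡ (⋆-delay (totals (E n)) (pairs f g) k) ⟨
    (eₓ ⋆ (λ z → pairs f g (suc k ℕ.+ z))) n + (totals (E n) ⋆ pairs f g) k ∎

-- Generating functions of colourings

allB-++ : ∀ {A : Set} (p : A → Bool) xs ys → allB p (xs ++ ys) ≡ allB p xs ∧ allB p ys
allB-++ p []       ys = ≡.refl
allB-++ p (x ∷ xs) ys = ≡.trans (≡.cong (p x ∧_) (allB-++ p xs ys)) (≡.sym (∧-assoc (p x) _ _))

allB-map : ∀ {A C : Set} (p : C → Bool) (f : A → C) xs → allB p (map f xs) ≡ allB (p ∘ f) xs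
allB-map p f []       = ≡.refl
allB-map p f (x ∷ xs) = ≡.cong (p (f x) ∧_) (allB-map p f xs)

allB-concatMap : ∀ {A C : Set} (p : C → Bool) (f : A → List C) xs →
                 allB p (concatMap f xs) ≡ allB (allB p ∘ f) xs
allB-concatMap p f []       = ≡.refl
allB-concatMap p f (x ∷ xs) = ≡.trans (allB-++ p (f x) (concatMap f xs)) (≡.cong (allB p (f x) ∧_) (allB-concatMap p f xs))

allB-cong : ∀ {A : Set} {p q : A → Bool} → p ≗ q → ∀ xs → allB p xs ≡ allB q xs
allB-cong e []       = ≡.refl
allB-cong e (x ∷ xs) = ≡.cong₂ _∧_ (e x) (allB-cong e xs)

∧-true : ∀ b {c} → b ∧ c ≡ true → b ≡ true × c ≡ true
∧-true true e = ≡.refl , e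

allB-tabulate⁺ : ∀ {A : Set} {n} (p : A → Bool) (f : Fin n → A) →
                 (∀ i → p (f i) ≡ true) → allB p (tabulate f) ≡ true
allB-tabulate⁺ {n = zero}  p f h = ≡.refl
allB-tabulate⁺ {n = suc n} p f h = ≡.cong₂ _∧_ (h zero) (allB-tabulate⁺ p (f ∘ suc) (h ∘ suc))

allB-tabulate⁻ : ∀ {A : Set} {n} (p : A → Bool) (f : Fin n → A) →
                 allB p (tabulate f) ≡ true → ∀ i → p (f i) ≡ true
allB-tabulate⁻ p f e zero    = proj₁ (∧-true (p (f zero)) e)
allB-tabulate⁻ p f e (suc i) = allB-tabulate⁻ p (f ∘ suc) (proj₂ (∧-true (p (f zero)) e)) i

module _ {L : ℕ} where

  proper-cong : ∀ {N} E {κ κ′ : Fin N → Fin L} → κ ≗ κ′ → proper E κ ≡ proper E κ′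
  proper-cong E e = allB-cong (λ (u , v) → ≡.cong₂ neq (e u) (e v)) E

  proper-map : ∀ {N N′} (f : Fin N → Fin N′) E (κ : Fin N′ → Fin L) →
               proper (map (mapPair f) E) κ ≡ proper E (κ ∘ f)
  proper-map f E κ = allB-map _ (mapPair f) E

  -- Three ways to extend a colouring, one per operation: `snocF` for `addVertex`, `appendF` for
  -- `attach`, `insertF` for a root at a given position. All are built from `consF`, so sums over
  -- colourings can be reindexed for summands that need not respect pointwise equality.
  snocF : ∀ {N} → (Fin N → Fin L) → Fin L → Fin (suc N) → Fin L
  snocF {zero}  κ c = consF c κ
  snocF {suc N} κ c = consF (κ zero) (snocF (κ ∘ suc) c)

  appendF : ∀ {N M} → (Fin N → Fin L) → (Fin M → Fin L) → Fin (N ℕ.+ M) → Fin L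
  appendF {zero}  κ κ′ = κ′
  appendF {suc N} κ κ′ = consF (κ zero) (appendF (κ ∘ suc) κ′)

  insertF : ∀ {N} → Fin (suc N) → Fin L → (Fin N → Fin L) → Fin (suc N) → Fin L
  insertF         zero    c κ = consF c κ
  insertF {suc N} (suc r) c κ = consF (κ zero) (insertF r c (κ ∘ suc))

  snocF-inject₁ : ∀ {N} (κ : Fin N → Fin L) c i → snocF κ c (inject₁ i) ≡ κ i
  snocF-inject₁ κ c zero    = ≡.refl
  snocF-inject₁ κ c (suc i) = snocF-inject₁ (κ ∘ suc) c i

  snocF-fromℕ : ∀ {N} (κ : Fin N → Fin L) c → snocF κ c (fromℕ N) ≡ c
  snocF-fromℕ {zero}  κ c = ≡.refl
  snocF-fromℕ {suc N} κ c = snocF-fromℕ (κ ∘ suc) c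

  appendF-↑ˡ : ∀ {N M} (κ : Fin N → Fin L) (κ′ : Fin M → Fin L) i → appendF κ κ′ (i ↑ˡ M) ≡ κ i
  appendF-↑ˡ κ κ′ zero    = ≡.refl
  appendF-↑ˡ κ κ′ (suc i) = appendF-↑ˡ (κ ∘ suc) κ′ i

  appendF-↑ʳ : ∀ {N M} (κ : Fin N → Fin L) (κ′ : Fin M → Fin L) j → appendF κ κ′ (N ↑ʳ j) ≡ κ′ j
  appendF-↑ʳ {zero}  κ κ′ j = ≡.refl
  appendF-↑ʳ {suc N} κ κ′ j = appendF-↑ʳ (κ ∘ suc) κ′ j

  insertF-root : ∀ {N} r c (κ : Fin N → Fin L) → insertF r c κ r ≡ c
  insertF-root         zero    c κ = ≡.refl
  insertF-root {suc N} (suc r) c κ = insertF-root r c (κ ∘ suc)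

  insertF-punchOut : ∀ {N} {r j : Fin (suc N)} (r≢j : r ≢ j) c (κ : Fin N → Fin L) →
                     insertF r c κ j ≡ κ (punchOut r≢j)
  insertF-punchOut {r = zero}  {zero}  r≢j c κ = ⊥-elim (r≢j ≡.refl)
  insertF-punchOut {r = zero}  {suc j} r≢j c κ = ≡.refl
  insertF-punchOut {suc N} {suc r} {zero}  r≢j c κ = ≡.refl
  insertF-punchOut {suc N} {suc r} {suc j} r≢j c κ = insertF-punchOut (r≢j ∘ ≡.cong suc) c (κ ∘ suc)

  appendF-embedR : ∀ G w R (κ : Fin (EGraph.N G) → Fin L) κ′ →
    appendF κ κ′ ∘ embedR G w R ≗ insertF (RootedGraph.root R) (κ w) κ′
  appendF-embedR G w R κ κ′ j with RootedGraph.root R ≟F j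
  ... | yes ≡.refl = ≡.trans (appendF-↑ˡ κ κ′ w) (≡.sym (insertF-root (RootedGraph.root R) (κ w) κ′))
  ... | no r≢j     = ≡.trans (appendF-↑ʳ κ κ′ _) (≡.sym (insertF-punchOut r≢j (κ w) κ′))

  avoids : ∀ {N} → Fin L → (Fin N → Fin L) → Bool
  avoids {zero}  c κ = true
  avoids {suc N} c κ = neq c (κ zero) ∧ avoids c (κ ∘ suc)

  -- Injectivity, tested vertex by vertex so that it unfolds along `consF`; choosing the first
  -- colour then leaves an `avoids` factor on the rest.
  distinct : ∀ {N} → (Fin N → Fin L) → Bool
  distinct {zero}  κ = true
  distinct {suc N} κ = avoids (κ zero) (κ ∘ suc) ∧ distinct (κ ∘ suc)

  avoids⁺ : ∀ {N} c (κ : Fin N → Fin L) → (∀ j → neq c (κ j) ≡ true) → avoids c κ ≡ true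
  avoids⁺ {zero}  c κ h = ≡.refl
  avoids⁺ {suc N} c κ h = ≡.cong₂ _∧_ (h zero) (avoids⁺ c (κ ∘ suc) (h ∘ suc))

  avoids⁻ : ∀ {N} c (κ : Fin N → Fin L) → avoids c κ ≡ true → ∀ j → neq c (κ j) ≡ true
  avoids⁻ c κ e zero    = proj₁ (∧-true (neq c (κ zero)) e)
  avoids⁻ c κ e (suc j) = avoids⁻ c (κ ∘ suc) (proj₂ (∧-true (neq c (κ zero)) e)) j

  distinct⁺ : ∀ {N} (κ : Fin N → Fin L) → (∀ i j → neq i j ≡ true → neq (κ i) (κ j) ≡ true) → distinct κ ≡ true
  distinct⁺ {zero}  κ h = ≡.refl
  distinct⁺ {suc N} κ h = ≡.cong₂ _∧_ (avoids⁺ (κ zero) (κ ∘ suc) (λ j → h zero (suc j) ≡.refl))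
    (distinct⁺ (κ ∘ suc) (λ i j e → h (suc i) (suc j) (≡.trans (neq-suc i j) e)))

  distinct⁻ : ∀ {N} (κ : Fin N → Fin L) → distinct κ ≡ true → ∀ i j → neq i j ≡ true → neq (κ i) (κ j) ≡ true
  distinct⁻ κ e zero    (suc j) _ = avoids⁻ (κ zero) (κ ∘ suc) (proj₁ (∧-true (avoids (κ zero) (κ ∘ suc)) e)) j
  distinct⁻ κ e (suc i) zero    _ = ≡.trans (neq-sym (κ (suc i)) (κ zero)) (distinct⁻ κ e zero (suc i) ≡.refl)
  distinct⁻ κ e (suc i) (suc j) h =
    distinct⁻ (κ ∘ suc) (proj₂ (∧-true (avoids (κ zero) (κ ∘ suc)) e)) i j (≡.trans (≡.sym (neq-suc i j)) h)

  -- Both tests are compared with the pointwise condition that different vertices get different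
  -- colours: the edge list runs over ordered pairs, `distinct` over each unordered pair once.
  proper-K : ∀ n (κ : Fin (suc n) → Fin L) → proper (edgesOf (K (suc n))) κ ≡ distinct κ
  proper-K n κ = ⇔→≡ {z = true} (mk⇔
    (λ e → distinct⁺ κ (λ i j ne → to i j ne
      (allB-tabulate⁻ (column i) id (allB-tabulate⁻ row id (≡.trans (≡.sym nested) e) i) j)))
    (λ e → ≡.trans nested
      (allB-tabulate⁺ row id (λ i → allB-tabulate⁺ (column i) id (λ j → from i j (distinct⁻ κ e i j))))))
    where
    edge : Fin (suc n) → Fin (suc n) → List (Fin (suc n) × Fin (suc n))
    edge i j = if neq i j then (i , j) ∷ [] else []
    column : Fin (suc n) → Fin (suc n) → Bool
    column i j = proper (edge i j) κ
    row : Fin (suc n) → Bool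
    row i = allB (column i) (allFin (suc n))
    q : Fin (suc n) × Fin (suc n) → Bool
    q (u , v) = neq (κ u) (κ v)
    nested : proper (edgesOf (K (suc n))) κ ≡ allB row (allFin (suc n))
    nested = ≡.trans
      (allB-concatMap q (λ i → concatMap (edge i) (allFin (suc n))) (allFin (suc n)))
      (allB-cong (λ i → allB-concatMap q (edge i) (allFin (suc n))) (allFin (suc n)))
    to : ∀ i j → neq i j ≡ true → column i j ≡ true → neq (κ i) (κ j) ≡ true
    to i j ne e with neq i j
    ... | true = proj₁ (∧-true (neq (κ i) (κ j)) e)
    from : ∀ i j → (neq i j ≡ true → neq (κ i) (κ j) ≡ true) → column i j ≡ true
    from i j h with neq i j
    ... | true  = ≡.trans (∧-identityʳ _) (h ≡.refl)
    ... | false = ≡.refl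

-- Partition functions and their transfer matrices

module Colouring (R : CommutativeRing 0ℓ 0ℓ) {L : ℕ} (x : Fin L → CommutativeRing.Carrier R) where
  open CommutativeRing R hiding (zero)
  open Elementary R
  open Transfer R x
  open Algebra.Properties.Semiring.Sum semiring using (sum; sum-cong-≋; ∑-comm; *-distribˡ-sum)
  open Algebra.Properties.Semiring.Mult semiring using (×-assoc-*; ×-comm-*; ×-congʳ; ×-assocˡ; ×-congˡ) renaming (_×_ to _⊠_)
  open Algebra.Solver.Ring.NaturalCoefficients.Default commutativeSemiring
    using (solve; _:=_; _:+_; _:*_; con)
  open Relation.Binary.Reasoning.Setoid setoid

  sumF : ∀ N → ((Fin N → Fin L) → Carrier) → Carrier
  sumF zero    φ = φ (λ ())
  sumF (suc N) φ = sum (λ c → sumF N (λ κ → φ (consF c κ)))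

  sumF-cong : ∀ N {φ ψ} → (∀ κ → φ κ ≈ ψ κ) → sumF N φ ≈ sumF N ψ
  sumF-cong zero    p = p _
  sumF-cong (suc N) p = sum-cong-≋ {L} (λ c → sumF-cong N (λ κ → p (consF c κ)))

  sumF-snoc : ∀ N φ → sumF (suc N) φ ≈ sumF N (λ κ → sum (λ c → φ (snocF κ c)))
  sumF-snoc zero    φ = refl
  sumF-snoc (suc N) φ = sum-cong-≋ {L} (λ c → sumF-snoc N (λ κ → φ (consF c κ)))

  sumF-append : ∀ N M φ → sumF (N ℕ.+ M) φ ≈ sumF N (λ κ → sumF M (λ κ′ → φ (appendF κ κ′)))
  sumF-append zero    M φ = refl
  sumF-append (suc N) M φ = sum-cong-≋ {L} (λ c → sumF-append N M (λ κ → φ (consF c κ)))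

  sumF-insert : ∀ N r φ → sumF (suc N) φ ≈ sum (λ c → sumF N (λ κ → φ (insertF r c κ)))
  sumF-insert N       zero    φ = refl
  sumF-insert (suc N) (suc r) φ = trans
    (sum-cong-≋ {L} (λ a → sumF-insert N r (λ κ → φ (consF a κ))))
    (∑-comm (λ a c → sumF N (λ κ → φ (consF a (insertF r c κ)))))

  sumF-scale : ∀ N c φ → sumF N (λ κ → c * φ κ) ≈ c * sumF N φ
  sumF-scale zero    c φ = refl
  sumF-scale (suc N) c φ = trans (sum-cong-≋ {L} (λ a → sumF-scale N c (λ κ → φ (consF a κ)))) (sym (*-distribˡ-sum c (λ a → sumF N (λ κ → φ (consF a κ)))))

  mono : (Fin L → Carrier) → ∀ {N} → (Fin N → Fin L) → Carrier
  mono y {zero}  κ = 1#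
  mono y {suc N} κ = y (κ zero) * mono y (κ ∘ suc)

  mono-snocF : ∀ {N} (κ : Fin N → Fin L) c → mono x (snocF κ c) ≈ mono x κ * x c
  mono-snocF {zero}  κ c = *-comm _ _
  mono-snocF {suc N} κ c = trans (*-congˡ (mono-snocF (κ ∘ suc) c)) (sym (*-assoc _ _ _))

  mono-appendF : ∀ {N M} (κ : Fin N → Fin L) (κ′ : Fin M → Fin L) → mono x (appendF κ κ′) ≈ mono x κ * mono x κ′
  mono-appendF {zero}  κ κ′ = sym (*-identityˡ _)
  mono-appendF {suc N} κ κ′ = trans (*-congˡ (mono-appendF (κ ∘ suc) κ′)) (sym (*-assoc _ _ _))

  mono-insertF : ∀ {N} r c (κ : Fin N → Fin L) → mono x (insertF r c κ) ≈ x c * mono x κ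
  mono-insertF         zero    c κ = refl
  mono-insertF {suc N} (suc r) c κ = trans (*-congˡ (mono-insertF r c (κ ∘ suc)))
    (solve 3 (λ p q r → p :* (q :* r) := q :* (p :* r)) refl _ _ _)

  weighted : (G : EGraph) → ((Fin (EGraph.N G) → Fin L) → Carrier) → (Fin (EGraph.N G) → Fin L) → Carrier
  weighted G φ κ = ⟦ proper (EGraph.E G) κ ⟧ * mono x κ * φ κ

  -- The test function `φ` makes each graph operation dual to an operation on functions: removing
  -- the piece built last changes `φ`, and the smaller graph remains.
  Z : (G : EGraph) → ((Fin (EGraph.N G) → Fin L) → Carrier) → Carrier
  Z G φ = sumF (EGraph.N G) (weighted G φ)

  Z-cong : ∀ G φ ψ → (∀ κ → φ κ ≈ ψ κ) → Z G φ ≈ Z G ψ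
  Z-cong G φ ψ p = sumF-cong (EGraph.N G) (λ κ → *-congˡ (p κ))

  Z-addVertex : ∀ G w φ → Z (addVertex G w) φ ≈ Z G (λ κ → sum (omit (κ w) (λ c → x c * φ (snocF κ c))))
  Z-addVertex G@(mkEG N Es) w φ = trans (sumF-snoc N (weighted (addVertex G w) φ)) (sumF-cong N (λ κ → trans
    (sum-cong-≋ {L} (λ c → begin
      ⟦ neq (snocF κ c (inject₁ w)) (snocF κ c (fromℕ N)) ∧ proper (map (mapPair inject₁) Es) (snocF κ c) ⟧
        * mono x (snocF κ c) * φ (snocF κ c)
        ≈⟨ *-congʳ (*-cong (trans (⟦⟧-cong (≡.cong₂ _∧_
             (≡.cong₂ neq (snocF-inject₁ κ c w) (snocF-fromℕ κ c))
             (≡.trans (proper-map inject₁ Es (snocF κ c)) (proper-cong Es (snocF-inject₁ κ c)))))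
             (⟦∧⟧ (neq (κ w) c) (proper Es κ))) (mono-snocF κ c)) ⟩
      ⟦ neq (κ w) c ⟧ * ⟦ proper Es κ ⟧ * (mono x κ * x c) * φ (snocF κ c)
        ≈⟨ solve 5 (λ n p m x f → n :* p :* (m :* x) :* f := p :* m :* (n :* (x :* f))) refl _ _ _ _ _ ⟩
      ⟦ proper Es κ ⟧ * mono x κ * omit (κ w) (λ c → x c * φ (snocF κ c)) c ∎))
    (sym (*-distribˡ-sum _ (omit (κ w) (λ c → x c * φ (snocF κ c)))))))

  -- The factor `φ` watches an old vertex `v` while the path is removed; in the spider it carries
  -- what the other legs have already contributed at the centre.
  Z-addPath : ∀ k G w v (φ f : Fun) →
    Z (Ext.G' (addPath G w k)) (λ κ → φ (κ (Ext.emb (addPath G w k) v)) * f (κ (Ext.pt (addPath G w k)))) ≈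
    Z G (λ κ → φ (κ v) * B^ k f (κ w))
  Z-addPath zero    G w v φ f = refl
  Z-addPath (suc k) G w v φ f = begin
    _ ≈⟨ Z-addPath k (addVertex G w) (fromℕ N) (inject₁ v) φ f ⟩
    Z (addVertex G w) (λ κ → φ (κ (inject₁ v)) * B^ k f (κ (fromℕ N)))
      ≈⟨ Z-addVertex G w (λ κ → φ (κ (inject₁ v)) * B^ k f (κ (fromℕ N))) ⟩
    Z G (λ κ → sum (omit (κ w) (λ c → x c * (φ (snocF κ c (inject₁ v)) * B^ k f (snocF κ c (fromℕ N))))))
      ≈⟨ Z-cong G _ (λ κ → φ (κ v) * B^ (suc k) f (κ w)) (λ κ → trans
           (sum-cong-≋ {L} (λ c → trans
             (*-congˡ (*-congˡ (*-cong (reflexive (≡.cong φ (snocF-inject₁ κ c v))) (reflexive (≡.cong (B^ k f) (snocF-fromℕ κ c))))))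
             (solve 4 (λ n x p f → n :* (x :* (p :* f)) := p :* (n :* (x :* f))) refl _ _ _ _)))
           (sym (*-distribˡ-sum (φ (κ v)) (omit (κ w) (λ c → x c * B^ k f c))))) ⟩
    Z G (λ κ → φ (κ v) * B^ (suc k) f (κ w)) ∎
    where N = EGraph.N G

  minus : RootedGraph → Fun
  minus R c = sumF (RootedGraph.n R) (λ κ → ⟦ proper (edgesOf R) (insertF (RootedGraph.root R) c κ) ⟧ * mono x κ)

  -- The weight of the shared vertex is already counted in `G`, so the attached copy contributes its
  -- generating function without the root weight.
  Z-attach : ∀ G w R v (φ : Fun) →
    Z (Ext.G' (attach G w R)) (λ κ → φ (κ (v ↑ˡ RootedGraph.n R))) ≈ Z G (λ κ → φ (κ v) * minus R (κ w))
  Z-attach G@(mkEG N Es) w R v φ = trans (sumF-append N n (weighted (Ext.G' (attach G w R)) (λ κ → φ (κ (v ↑ˡ n))))) (sumF-cong N (λ κ → trans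
    (sumF-cong n (λ κ′ → begin
      ⟦ proper (map (mapPair (_↑ˡ n)) Es ++ map (mapPair (embedR G w R)) (edgesOf R)) (appendF κ κ′) ⟧
        * mono x (appendF κ κ′) * φ (appendF κ κ′ (v ↑ˡ n))
        ≈⟨ *-cong (*-cong (trans (⟦⟧-cong (≡.trans (allB-++ _ (map (mapPair (_↑ˡ n)) Es) _) (≡.cong₂ _∧_
             (≡.trans (proper-map (_↑ˡ n) Es (appendF κ κ′)) (proper-cong Es (appendF-↑ˡ κ κ′)))
             (≡.trans (proper-map (embedR G w R) (edgesOf R) (appendF κ κ′)) (proper-cong (edgesOf R) (appendF-embedR G w R κ κ′))))))
             (⟦∧⟧ (proper Es κ) _)) (mono-appendF κ κ′)) (reflexive (≡.cong φ (appendF-↑ˡ κ κ′ v))) ⟩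
      ⟦ proper Es κ ⟧ * ⟦ proper (edgesOf R) (insertF root (κ w) κ′) ⟧ * (mono x κ * mono x κ′) * φ (κ v)
        ≈⟨ solve 5 (λ p q m m′ f → p :* q :* (m :* m′) :* f := p :* m :* f :* (q :* m′)) refl _ _ _ _ _ ⟩
      ⟦ proper Es κ ⟧ * mono x κ * φ (κ v) * (⟦ proper (edgesOf R) (insertF root (κ w) κ′) ⟧ * mono x κ′) ∎))
    (trans (sumF-scale n _ _) (*-assoc _ _ _))))
    where open RootedGraph R using (n; root)

  Z-toEG : ∀ R (f : Fun) → Z (toEG R) (λ κ → f (κ (RootedGraph.root R))) ≈ pair (minus R) f
  Z-toEG R f = trans (sumF-insert n root (weighted (toEG R) (λ κ → f (κ root)))) (sum-cong-≋ {L} (λ c → trans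
    (sumF-cong n (λ κ → trans
      (*-cong (*-congˡ (mono-insertF root c κ)) (reflexive (≡.cong f (insertF-root root c κ))))
      (solve 4 (λ p x m f → p :* (x :* m) :* f := x :* f :* (p :* m)) refl _ _ _ _)))
    (trans (sumF-scale n (x c * f c) _) (solve 3 (λ x f m → x :* f :* m := x :* (m :* f)) refl _ _ _))))
    where open RootedGraph R using (n; root)

  Z-point : ∀ (f : Fun) → Z (mkEG 1 []) (λ κ → f (κ zero)) ≈ total f
  Z-point f = sum-cong-≋ {L} (λ c → solve 2 (λ x f → con 1 :* (x :* con 1) :* f := x :* f) refl _ _)

  chromatic : EGraph → Carrier
  chromatic G = Z G (λ _ → 1#)

  𝟙 : Fun
  𝟙 _ = 1#

  -- The factor `1#` is kept so that the result has the form of a product to which `Z-addPath`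
  -- applies.
  chromatic-attach : ∀ G w R → chromatic (Ext.G' (attach G w R)) ≈ Z G (λ κ → 1# * minus R (κ w))
  chromatic-attach G w R = Z-attach G w R w 𝟙

  chromatic-P : ∀ k G H → chromatic (P k G H) ≈ pairs (minus G) (minus H) k
  chromatic-P k G H = begin
    chromatic (P k G H)
      ≈⟨ chromatic-attach (Ext.G' path) (Ext.pt path) H ⟩
    Z (Ext.G' path) (λ κ → 1# * minus H (κ (Ext.pt path)))
      ≈⟨ Z-addPath k (toEG G) root root 𝟙 (minus H) ⟩
    Z (toEG G) (λ κ → 1# * B^ k (minus H) (κ root))
      ≈⟨ Z-cong (toEG G) (λ κ → 1# * B^ k (minus H) (κ root)) _ (λ κ → *-identityˡ _) ⟩
    Z (toEG G) (λ κ → B^ k (minus H) (κ root))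
      ≈⟨ Z-toEG G (B^ k (minus H)) ⟩
    pair (minus G) (B^ k (minus H))
      ≈⟨ B^-selfAdjoint k (minus G) (minus H) ⟨
    pairs (minus G) (minus H) k ∎
    where
    open RootedGraph G using (root)
    path = addPath (toEG G) root k

  chromatic-tailG : ∀ G k → chromatic (tailG G k) ≈ totals (minus G) k
  chromatic-tailG G k = trans (chromatic-P k G K1)
    (total-cong (λ _ → trans (*-congˡ (*-identityˡ _)) (*-identityʳ _)))

  -- The pieces are stripped in the reverse order of construction, and the test function at the
  -- centre gains one factor per leg.
  chromatic-spider : ∀ t₁ t₂ t₃ G₁ G₂ G₃ → chromatic (spider t₁ t₂ t₃ G₁ G₂ G₃) ≈
    triple (B^ t₁ (minus G₁)) (B^ t₂ (minus G₂)) (B^ t₃ (minus G₃))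
  chromatic-spider t₁ t₂ t₃ G₁ G₂ G₃ = begin
    chromatic (spider t₁ t₂ t₃ G₁ G₂ G₃)
      ≈⟨ chromatic-attach (Ext.G' e₃) (Ext.pt e₃) G₃ ⟩
    Z (Ext.G' e₃) (λ κ → 1# * minus G₃ (κ (Ext.pt e₃)))
      ≈⟨ Z-addPath t₃ (Ext.G' a₂) c₂ c₂ 𝟙 (minus G₃) ⟩
    Z (Ext.G' a₂) (λ κ → 1# * B^ t₃ (minus G₃) (κ c₂))
      ≈⟨ Z-attach (Ext.G' e₂) (Ext.pt e₂) G₂ (Ext.emb e₂ c₁) (λ c → 1# * B^ t₃ (minus G₃) c) ⟩
    Z (Ext.G' e₂) (λ κ → 1# * B^ t₃ (minus G₃) (κ (Ext.emb e₂ c₁)) * minus G₂ (κ (Ext.pt e₂)))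
      ≈⟨ Z-addPath t₂ (Ext.G' a₁) c₁ c₁ (λ c → 1# * B^ t₃ (minus G₃) c) (minus G₂) ⟩
    Z (Ext.G' a₁) (λ κ → 1# * B^ t₃ (minus G₃) (κ c₁) * B^ t₂ (minus G₂) (κ c₁))
      ≈⟨ Z-attach (Ext.G' e₁) (Ext.pt e₁) G₁ (Ext.emb e₁ zero) (λ c → 1# * B^ t₃ (minus G₃) c * B^ t₂ (minus G₂) c) ⟩
    Z (Ext.G' e₁) (λ κ → 1# * B^ t₃ (minus G₃) (κ (Ext.emb e₁ zero)) * B^ t₂ (minus G₂) (κ (Ext.emb e₁ zero)) * minus G₁ (κ (Ext.pt e₁)))
      ≈⟨ Z-addPath t₁ point zero zero (λ c → 1# * B^ t₃ (minus G₃) c * B^ t₂ (minus G₂) c) (minus G₁) ⟩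
    Z point (λ κ → 1# * B^ t₃ (minus G₃) (κ zero) * B^ t₂ (minus G₂) (κ zero) * B^ t₁ (minus G₁) (κ zero))
      ≈⟨ Z-point (λ c → 1# * B^ t₃ (minus G₃) c * B^ t₂ (minus G₂) c * B^ t₁ (minus G₁) c) ⟩
    total (λ c → 1# * B^ t₃ (minus G₃) c * B^ t₂ (minus G₂) c * B^ t₁ (minus G₁) c)
      ≈⟨ total-cong (λ c → solve 3 (λ f g h → con 1 :* h :* g :* f := f :* g :* h) refl _ _ _) ⟩
    triple (B^ t₁ (minus G₁)) (B^ t₂ (minus G₂)) (B^ t₃ (minus G₃)) ∎
    where
    point = mkEG 1 []
    e₁ = addPath point zero t₁
    a₁ = attach (Ext.G' e₁) (Ext.pt e₁) G₁
    c₁ = Ext.emb a₁ (Ext.emb e₁ zero)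
    e₂ = addPath (Ext.G' a₁) c₁ t₂
    a₂ = attach (Ext.G' e₂) (Ext.pt e₂) G₂
    c₂ = Ext.emb a₂ (Ext.emb e₂ c₁)
    e₃ = addPath (Ext.G' a₂) c₂ t₃

  mono-omit : ∀ {N} c y (κ : Fin N → Fin L) → ⟦ avoids c κ ⟧ * mono y κ ≈ mono (omit c y) κ
  mono-omit {zero}  c y κ = *-identityˡ _
  mono-omit {suc N} c y κ = begin
    ⟦ neq c (κ zero) ∧ avoids c (κ ∘ suc) ⟧ * (y (κ zero) * mono y (κ ∘ suc))
      ≈⟨ *-congʳ (⟦∧⟧ (neq c (κ zero)) _) ⟩
    ⟦ neq c (κ zero) ⟧ * ⟦ avoids c (κ ∘ suc) ⟧ * (y (κ zero) * mono y (κ ∘ suc))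
      ≈⟨ solve 4 (λ p q r s → p :* q :* (r :* s) := p :* r :* (q :* s)) refl _ _ _ _ ⟩
    ⟦ neq c (κ zero) ⟧ * y (κ zero) * (⟦ avoids c (κ ∘ suc) ⟧ * mono y (κ ∘ suc))
      ≈⟨ *-congˡ (mono-omit c y (κ ∘ suc)) ⟩
    mono (omit c y) κ ∎

  sumDistinct : ℕ → (Fin L → Carrier) → Carrier
  sumDistinct n y = sumF n (λ κ → ⟦ distinct κ ⟧ * mono y κ)

  sumDistinct-omit : ∀ n y c → sumF n (λ κ → ⟦ avoids c κ ∧ distinct κ ⟧ * mono y κ) ≈ sumDistinct n (omit c y)
  sumDistinct-omit n y c = sumF-cong n (λ κ → begin
    ⟦ avoids c κ ∧ distinct κ ⟧ * mono y κ     ≈⟨ *-congʳ (⟦∧⟧ (avoids c κ) _) ⟩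
    ⟦ avoids c κ ⟧ * ⟦ distinct κ ⟧ * mono y κ ≈⟨ solve 3 (λ p q r → p :* q :* r := q :* (p :* r)) refl _ _ _ ⟩
    ⟦ distinct κ ⟧ * (⟦ avoids c κ ⟧ * mono y κ) ≈⟨ *-congˡ (mono-omit c y κ) ⟩
    ⟦ distinct κ ⟧ * mono (omit c y) κ ∎)

  -- Once the first vertex has colour `c`, forbidding `c` elsewhere amounts to setting `y c` to
  -- zero, hence the induction for all weights `y`. The new factor `suc n` of the factorial comes
  -- from `sum-el-omit`.
  sumDistinct-el : ∀ n y → sumDistinct n y ≈ (n !) ⊠ el n y
  sumDistinct-el zero    y = solve 0 (con 1 :* con 1 := con 1 :+ con 0) refl
  sumDistinct-el (suc n) y = begin
    sumDistinct (suc n) y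
      ≈⟨ sum-cong-≋ {L} (λ c → trans
           (sumF-cong n (λ κ → solve 3 (λ p q r → p :* (q :* r) := q :* (p :* r)) refl _ (y c) _))
           (trans (sumF-scale n (y c) _) (*-congˡ (trans (sumDistinct-omit n y c) (sumDistinct-el n (omit c y)))))) ⟩
    sum (λ c → y c * ((n !) ⊠ el n (omit c y)))
      ≈⟨ sum-cong-≋ {L} (λ c → trans (×-comm-* (n !) _ _) (×-as-* (n !) _)) ⟩
    sum (λ c → ((n !) ⊠ 1#) * (y c * el n (omit c y)))
      ≈⟨ *-distribˡ-sum ((n !) ⊠ 1#) (λ c → y c * el n (omit c y)) ⟨
    ((n !) ⊠ 1#) * sum (λ c → y c * el n (omit c y))
      ≈⟨ *-congˡ (sum-el-omit n y) ⟩
    ((n !) ⊠ 1#) * (suc n ⊠ el (suc n) y)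
      ≈⟨ ×-as-* (n !) _ ⟨
    (n !) ⊠ (suc n ⊠ el (suc n) y)
      ≈⟨ trans (×-assocˡ (el (suc n) y) (n !) (suc n)) (×-congˡ (ℕₚ.*-comm (n !) (suc n))) ⟩
    (suc n !) ⊠ el (suc n) y ∎
    where
    ×-as-* : ∀ m z → m ⊠ z ≈ (m ⊠ 1#) * z
    ×-as-* m z = sym (trans (×-assoc-* m 1# z) (×-congʳ m (*-identityˡ z)))

  minus-K : ∀ n → minus (K (suc n)) ≋ (λ c → ((n !) ⊠ 1#) * E n c)
  minus-K n c = begin
    minus (K (suc n)) c
      ≈⟨ sumF-cong n (λ κ → *-congʳ (⟦⟧-cong (proper-K n (consF c κ)))) ⟩
    sumF n (λ κ → ⟦ avoids c κ ∧ distinct κ ⟧ * mono x κ)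
      ≈⟨ trans (sumDistinct-omit n x c) (sumDistinct-el n (omit c x)) ⟩
    (n !) ⊠ E n c  ≈⟨ trans (×-assoc-* (n !) 1# _) (×-congʳ (n !) (*-identityˡ _)) ⟨
    ((n !) ⊠ 1#) * E n c ∎

-- Symmetric functions in L variables as iterated power series

open Defs using (_≈_)

polynomialRing : ℕ → CommutativeRing 0ℓ 0ℓ
polynomialRing zero    = ℤₚ.+-*-commutativeRing
polynomialRing (suc L) = powerSeriesRing (polynomialRing L)

module Poly (L : ℕ) = CommutativeRing (polynomialRing L)

vars : ∀ L → Fin L → Poly.Carrier L
vars (suc L) zero    = delay (constant (Poly.1# L))
  where open Convolution (polynomialRing L)
vars (suc L) (suc i) = constant (vars L i)
  where open Convolution (polynomialRing L)

-- Currying of the coefficient function. Only lists of length `L` are kept; this suffices because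
-- every operation involved computes its value at a list from values at lists of the same length.
restrict : ∀ L → SF → Poly.Carrier L
restrict zero    f   = f []
restrict (suc L) f a = restrict L (λ β → f (a ∷ β))

coeff : (α : Mono) → Poly.Carrier (length α) → ℤ
coeff []      p = p
coeff (a ∷ α) p = coeff α (p a)

coeff-restrict : ∀ f α → coeff α (restrict (length α) f) ≡ f α
coeff-restrict f []      = ≡.refl
coeff-restrict f (a ∷ α) = coeff-restrict (λ β → f (a ∷ β)) α

coeff-cong : ∀ α {p q} → Poly._≈_ (length α) p q → coeff α p ≡ coeff α q
coeff-cong []      e = e
coeff-cong (a ∷ α) e = coeff-cong α (e a)

coeff-0 : ∀ α → coeff α (Poly.0# (length α)) ≡ + 0
coeff-0 []      = ≡.refl
coeff-0 (a ∷ α) = coeff-0 α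

coeff-+ : ∀ α p q → coeff α (Poly._+_ (length α) p q) ≡ coeff α p ℤ.+ coeff α q
coeff-+ []      p q = ≡.refl
coeff-+ (a ∷ α) p q = coeff-+ α (p a) (q a)

coeffV : ∀ {L} → Vec ℕ L → Poly.Carrier L → ℤ
coeffV []      p = p
coeffV (a ∷ v) p = coeffV v (p a)

coeffV-ext : ∀ L {p q} → (∀ (v : Vec ℕ L) → coeffV v p ≡ coeffV v q) → Poly._≈_ L p q
coeffV-ext zero    h   = h []
coeffV-ext (suc L) h a = coeffV-ext L (λ v → h (a ∷ v))

-- Quantifying over a family p avoids transporting along length (toList v) ≡ L.
coeff-toList : ∀ (p : ∀ L → Poly.Carrier L) {L} (v : Vec ℕ L) →
               coeff (toList v) (p (length (toList v))) ≡ coeffV v (p L)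
coeff-toList p []      = ≡.refl
coeff-toList p (a ∷ v) = coeff-toList (λ L → p (suc L) a) v

-- Chromatic coefficients are computed at α only in exactly `length α` variables; this passes from
-- there to an equation in the ring for every `L`.
coeff-ext : ∀ (p q : ∀ L → Poly.Carrier L) → (∀ α → coeff α (p (length α)) ≡ coeff α (q (length α))) →
            ∀ L → Poly._≈_ L (p L) (q L)
coeff-ext p q h L = coeffV-ext L (λ v →
  ≡.trans (≡.sym (coeff-toList p v)) (≡.trans (h (toList v)) (coeff-toList q v)))

restrict-cong : ∀ L {f g} → f ≈ g → Poly._≈_ L (restrict L f) (restrict L g)
restrict-cong zero    e   = e []
restrict-cong (suc L) e a = restrict-cong L (λ β → e (a ∷ β))

restrict-0 : ∀ L → Poly._≈_ L (restrict L zeroSF) (Poly.0# L)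
restrict-0 zero      = ≡.refl
restrict-0 (suc L) a = restrict-0 L

restrict-⊕ : ∀ L f g → Poly._≈_ L (restrict L (f ⊕ g)) (Poly._+_ L (restrict L f) (restrict L g))
restrict-⊕ zero    f g   = ≡.refl
restrict-⊕ (suc L) f g a = restrict-⊕ L (λ β → f (a ∷ β)) (λ β → g (a ∷ β))

restrict-⊖ : ∀ L f g → Poly._≈_ L (restrict L (f ⊖ g)) (Poly._-_ L (restrict L f) (restrict L g))
restrict-⊖ zero    f g   = ≡.refl
restrict-⊖ (suc L) f g a = restrict-⊖ L (λ β → f (a ∷ β)) (λ β → g (a ∷ β))

sumℤ-++ : ∀ xs ys → sumℤ (xs ++ ys) ≡ sumℤ xs ℤ.+ sumℤ ys
sumℤ-++ []       ys = ≡.sym (ℤₚ.+-identityˡ _)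
sumℤ-++ (x ∷ xs) ys = ≡.trans (≡.cong (ℤ._+_ x) (sumℤ-++ xs ys)) (≡.sym (ℤₚ.+-assoc x _ _))

sumℤ-concatMap : ∀ {A C : Set} (h : C → ℤ) (f : A → List C) xs →
                 sumℤ (map h (concatMap f xs)) ≡ sumℤ (map (λ x → sumℤ (map h (f x))) xs)
sumℤ-concatMap h f []       = ≡.refl
sumℤ-concatMap h f (x ∷ xs) = ≡.trans (≡.cong sumℤ (map-++ h (f x) (concatMap f xs)))
  (≡.trans (sumℤ-++ (map h (f x)) _) (≡.cong (ℤ._+_ (sumℤ (map h (f x)))) (sumℤ-concatMap h f xs)))

sumSF-apply : ∀ {A : Set} (h : A → SF) xs α → sumSF (map h xs) α ≡ sumℤ (map (λ x → h x α) xs)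
sumSF-apply h []       α = ≡.refl
sumSF-apply h (x ∷ xs) α = ≡.cong (ℤ._+_ (h x α)) (sumSF-apply h xs α)

-- Grouping by the exponent of the first variable exhibits `⊛` as a Cauchy product in that variable,
-- with `⊛` in the remaining ones multiplying its coefficients.
⊛-cons : ∀ f g a α → (f ⊛ g) (a ∷ α) ≡
         sumSF (map (λ b → (λ β → f (b ∷ β)) ⊛ (λ β → g (a ∸ b ∷ β))) (upTo (suc a))) α
⊛-cons f g a α = begin
  sumℤ (map h (concatMap (λ b → map (b ∷_) (subMonos α)) (upTo (suc a))))
    ≡⟨ sumℤ-concatMap h (λ b → map (b ∷_) (subMonos α)) (upTo (suc a)) ⟩
  sumℤ (map (λ b → sumℤ (map h (map (b ∷_) (subMonos α)))) (upTo (suc a)))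
    ≡⟨ ≡.cong sumℤ (map-cong (λ b → ≡.cong sumℤ (≡.sym (map-∘ {g = h} {f = b ∷_} (subMonos α)))) (upTo (suc a))) ⟩
  sumℤ (map (λ b → sumℤ (map (h ∘ (b ∷_)) (subMonos α))) (upTo (suc a)))
    ≡⟨ sumSF-apply (λ b → (λ β → f (b ∷ β)) ⊛ (λ β → g (a ∸ b ∷ β))) (upTo (suc a)) α ⟨
  sumSF (map (λ b → (λ β → f (b ∷ β)) ⊛ (λ β → g (a ∸ b ∷ β))) (upTo (suc a))) α ∎
  where
  open ≡.≡-Reasoning
  h : Mono → ℤ
  h β = f β ℤ.* g (zipWith _∸_ (a ∷ α) β)

-- Finite sums and products of coefficient functions

module FiniteSums (R : CommutativeRing 0ℓ 0ℓ) where
  open CommutativeRing R hiding (zero) renaming (_≈_ to _≋_)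
  open Convolution R
  open Elementary R using (⟦_⟧)
  open Algebra.Properties.Semiring.Sum semiring using (sum; sum-cong-≋; sum-replicate-zero)

  ⋆-sum : ∀ f g n → (f ⋆ g) n ≋ sum {suc n} (λ i → f (toℕ i) * g (n ∸ toℕ i))
  ⋆-sum f g zero    = sym (+-identityʳ _)
  ⋆-sum f g (suc n) = +-congˡ (⋆-sum (f ∘ suc) g n)

  sum-zero : ∀ n {f : Fin n → Carrier} → (∀ i → f i ≋ 0#) → sum f ≋ 0#
  sum-zero n p = trans (sum-cong-≋ {n} p) (sum-replicate-zero n)

  sum-pick : ∀ M n (h : ℕ → Carrier) → n < M → sum {M} (λ c → ⟦ toℕ c ≡ᵇ n ⟧ * h (toℕ c)) ≋ h n
  sum-pick (suc M) zero    h _       = trans (+-cong (*-identityˡ _) (sum-zero M (λ _ → zeroˡ _))) (+-identityʳ _)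
  sum-pick (suc M) (suc n) h (s≤s p) = trans (+-cong (zeroˡ _) (sum-pick M n (h ∘ suc) p)) (+-identityˡ _)

  -- The bounds ensure that the box contains the whole antidiagonal b + c = n - 1. For n = 0 the
  -- test never succeeds, in agreement with `delay`.
  sum-antidiagonal : ∀ M M′ n (p q : ℕ → Carrier) → n ≤ M → n ≤ M′ →
    sum {M} (λ b → sum {M′} (λ c → ⟦ suc (toℕ b ℕ.+ toℕ c) ≡ᵇ n ⟧ * (p (toℕ b) * q (toℕ c)))) ≋ delay (p ⋆ q) n
  sum-antidiagonal M       M′ zero    p q _       _ = sum-zero M (λ _ → sum-zero M′ (λ _ → zeroˡ _))
  sum-antidiagonal (suc M) M′ (suc n) p q (s≤s l) l′ = trans
    (+-cong (sum-pick M′ n (λ c → p 0 * q c) l′)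
            (sum-antidiagonal M M′ n (p ∘ suc) q l (ℕₚ.≤-trans (ℕₚ.n≤1+n n) l′)))
    (sym (⋆-unfold p q n))

module RestrictSum (L : ℕ) where
  open Poly L hiding (zero; _≈_)
  open Algebra.Properties.Semiring.Sum semiring using (sum; sum-cong-≋)
  open Algebra.Properties.Semiring.Mult semiring using () renaming (_×_ to _⊠_)
  open Elementary (polynomialRing L) using (⟦_⟧)

  infix 4 _≋_
  _≋_ : Carrier → Carrier → Set
  _≋_ = Poly._≈_ L

  restrictSum : ∀ {A : Set} → (A → SF) → List A → Carrier
  restrictSum h xs = restrict L (sumSF (map h xs))

  restrictSum-∷ : ∀ {A : Set} (h : A → SF) x xs → restrictSum h (x ∷ xs) ≋ restrict L (h x) + restrictSum h xs
  restrictSum-∷ h x xs = restrict-⊕ L (h x) (sumSF (map h xs))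

  restrictSum-++ : ∀ {A : Set} (h : A → SF) xs ys → restrictSum h (xs ++ ys) ≋ restrictSum h xs + restrictSum h ys
  restrictSum-++ h []       ys = trans (sym (+-identityˡ _)) (+-congʳ (sym (restrict-0 L)))
  restrictSum-++ h (x ∷ xs) ys = trans (restrictSum-∷ h x (xs ++ ys)) (trans (+-congˡ (restrictSum-++ h xs ys))
    (trans (sym (+-assoc _ _ _)) (+-congʳ (sym (restrictSum-∷ h x xs)))))

  restrictSum-applyUpTo : ∀ {A : Set} (h : A → SF) (f : ℕ → A) n →
                          restrictSum h (applyUpTo f n) ≋ sum {n} (λ i → restrict L (h (f (toℕ i))))
  restrictSum-applyUpTo h f zero    = restrict-0 L
  restrictSum-applyUpTo h f (suc n) = trans (restrictSum-∷ h (f 0) (applyUpTo (f ∘ suc) n))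
    (+-congˡ (restrictSum-applyUpTo h (f ∘ suc) n))

  restrictSum-concatMap : ∀ {A : Set} (h : A → SF) (f : ℕ → List A) g n →
                          restrictSum h (concatMap f (applyUpTo g n)) ≋ sum {n} (λ i → restrictSum h (f (g (toℕ i))))
  restrictSum-concatMap h f g zero    = restrict-0 L
  restrictSum-concatMap h f g (suc n) = trans (restrictSum-++ h (f (g 0)) (concatMap f (applyUpTo (g ∘ suc) n)))
    (+-congˡ (restrictSum-concatMap h f (g ∘ suc) n))

  restrictSum-if : ∀ {A : Set} (h : A → SF) b x → restrictSum h (if b then x ∷ [] else []) ≋ ⟦ b ⟧ * restrict L (h x)
  restrictSum-if h true  x = trans (restrictSum-∷ h x []) (trans (+-congˡ (restrict-0 L)) (trans (+-identityʳ _) (sym (*-identityˡ _))))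
  restrictSum-if h false x = trans (restrict-0 L) (sym (zeroˡ _))

  restrictSum-triples : ∀ h k m → restrictSum h (triples k m) ≋
    sum {m} (λ a → sum {k ℕ.+ m} (λ b → sum {k ℕ.+ m} (λ c →
      ⟦ toℕ a ℕ.+ toℕ b ℕ.+ toℕ c ℕ.+ 2 ≡ᵇ k ℕ.+ m ⟧ * restrict L (h (toℕ a , toℕ b , toℕ c)))))
  restrictSum-triples h k m = trans (restrictSum-concatMap h slice id m) (sum-cong-≋ {m} (λ a →
    trans (restrictSum-concatMap h (row (toℕ a)) id (k ℕ.+ m)) (sum-cong-≋ {k ℕ.+ m} (λ b →
    trans (restrictSum-concatMap h (cell (toℕ a) (toℕ b)) id (k ℕ.+ m)) (sum-cong-≋ {k ℕ.+ m} (λ c →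
    restrictSum-if h (toℕ a ℕ.+ toℕ b ℕ.+ toℕ c ℕ.+ 2 ≡ᵇ k ℕ.+ m) (toℕ a , toℕ b , toℕ c)))))))
    where
    cell : ℕ → ℕ → ℕ → List (ℕ × ℕ × ℕ)
    cell a b c = if a ℕ.+ b ℕ.+ c ℕ.+ 2 ≡ᵇ k ℕ.+ m then (a , b , c) ∷ [] else []
    row : ℕ → ℕ → List (ℕ × ℕ × ℕ)
    row a b = concatMap (cell a b) (upTo (k ℕ.+ m))
    slice : ℕ → List (ℕ × ℕ × ℕ)
    slice a = concatMap (row a) (upTo (k ℕ.+ m))

  restrict-·ℕ : ∀ n f → restrict L ((+ n) · f) ≋ n ⊠ restrict L f
  restrict-·ℕ zero    f = trans (restrict-cong L (λ α → ℤₚ.*-zeroˡ (f α))) (restrict-0 L)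
  restrict-·ℕ (suc n) f = trans (restrict-cong L (λ α → ℤₚ.suc-* (+ n) (f α)))
    (trans (restrict-⊕ L f ((+ n) · f)) (+-congˡ (restrict-·ℕ n f)))

  restrict-·1- : ∀ a f → restrict L ((+ 1 ℤ.- + a) · f) ≋ restrict L f - a ⊠ restrict L f
  restrict-·1- a f = trans
    (restrict-cong L (λ α → ≡.trans (ℤₚ.*-distribʳ-+ (f α) (+ 1) (ℤ.- + a))
      (≡.cong₂ ℤ._+_ (ℤₚ.*-identityˡ (f α)) (≡.sym (ℤₚ.neg-distribˡ-* (+ a) (f α))))))
    (trans (restrict-⊖ L f ((+ a) · f)) (+-congˡ (-‿cong (restrict-·ℕ a f))))

restrict-⊛ : ∀ L f g → Poly._≈_ L (restrict L (f ⊛ g)) (Poly._*_ L (restrict L f) (restrict L g))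
restrict-⊛ zero    f g   = ℤₚ.+-identityʳ _
restrict-⊛ (suc L) f g a = trans (restrict-cong L (⊛-cons f g a)) (trans
  (restrictSum-applyUpTo (λ b → (λ β → f (b ∷ β)) ⊛ (λ β → g (a ∸ b ∷ β))) id (suc a))
  (trans (sum-cong-≋ {suc a} (λ i → restrict-⊛ L (λ β → f (toℕ i ∷ β)) (λ β → g (a ∸ toℕ i ∷ β))))
  (sym (⋆-sum (restrict (suc L) f) (restrict (suc L) g) a))))
  where
  open Poly L using (trans; sym; semiring)
  open RestrictSum L
  open FiniteSums (polynomialRing L)
  open Algebra.Properties.Semiring.Sum semiring using (sum-cong-≋)

-- Coefficients of the elementary symmetric functions

module ElementaryCoefficients (L : ℕ) where
  open Poly L hiding (zero; _≈_)
  open Convolution (polynomialRing L)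
  open RestrictSum L using (_≋_)
  private module El  = Elementary (polynomialRing L)
  private module El⁺ = Elementary (polynomialRing (suc L))

  el-constant : ∀ {M} a (y : Fin M → Carrier) n → El⁺.el a (λ i → constant (y i)) n ≋ constant (El.el a y) n
  el-constant         zero    y n       = refl
  el-constant {zero}  (suc a) y zero    = refl
  el-constant {zero}  (suc a) y (suc n) = refl
  el-constant {suc M} (suc a) y n       = trans
    (+-cong (el-constant (suc a) (y ∘ suc) n)
            (trans (constant-⋆ _ _ n) (*-congˡ (el-constant a (y ∘ suc) n))))
    (constants n)
    where
    constants : ∀ n → constant (El.el (suc a) (y ∘ suc)) n + y zero * constant (El.el a (y ∘ suc)) n ≋
                      constant (El.el (suc a) y) n
    constants zero    = refl
    constants (suc n) = trans (+-congˡ (zeroʳ _)) (+-identityˡ _)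

  var-zero-⋆ : ∀ g n → (vars (suc L) zero ⋆ g) n ≋ delay g n
  var-zero-⋆ g zero    = zeroˡ _
  var-zero-⋆ g (suc n) = trans (+-cong (zeroˡ _) (trans (constant-⋆ 1# g n) (*-identityˡ _))) (+-identityˡ _)

-- Exponents 0 and 1 of the first variable give the two terms in the recursion of `el`; larger
-- exponents fail the squarefreeness test.
restrict-e : ∀ L a → Poly._≈_ L (restrict L (e a)) (Elementary.el (polynomialRing L) a (vars L))
restrict-e zero    zero    = ≡.refl
restrict-e zero    (suc a) = ≡.refl
restrict-e (suc L) zero    zero          = restrict-e L zero
restrict-e (suc L) zero    (suc zero)    =
  Poly.trans L (restrict-cong L (λ β → ≡.cong (if_then + 1 else + 0) (∧-zeroʳ _))) (restrict-0 L)
restrict-e (suc L) zero    (suc (suc n)) = restrict-0 L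
restrict-e (suc L) (suc a) n = trans (at n) (sym
  (+-cong (el-constant (suc a) (vars L) n)
          (trans (var-zero-⋆ _ n) (delay-cong (el-constant a (vars L)) n))))
  where
  open Poly L hiding (zero; _≈_)
  open Convolution (polynomialRing L)
  open Elementary (polynomialRing L)
  open ElementaryCoefficients L
  at : ∀ n → Poly._≈_ L (restrict (suc L) (e (suc a)) n)
                        (constant (el (suc a) (vars L)) n + delay (constant (el a (vars L))) n)
  at zero          = trans (restrict-e L (suc a)) (sym (+-identityʳ _))
  at (suc zero)    = trans (restrict-e L a) (sym (+-identityˡ _))
  at (suc (suc n)) = trans (restrict-0 L) (sym (+-identityˡ _))

-- Chromatic coefficients as counts of colourings

monomial : ∀ L → (Fin L → ℕ) → Poly.Carrier L
monomial zero    μ   = + 1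
monomial (suc L) μ a = if μ zero ≡ᵇ a then monomial L (μ ∘ suc) else Poly.0# L

monomial-cong : ∀ L {μ ν} → μ ≗ ν → Poly._≈_ L (monomial L μ) (monomial L ν)
monomial-cong zero    h = ≡.refl
monomial-cong (suc L) {μ} {ν} h a with μ zero | h zero
... | _ | ≡.refl with ν zero ≡ᵇ a
... | true  = monomial-cong L (h ∘ suc)
... | false = Poly.refl L

monomial-1 : ∀ L → Poly._≈_ L (Poly.1# L) (monomial L (λ _ → 0))
monomial-1 zero            = ≡.refl
monomial-1 (suc L) zero    = monomial-1 L
monomial-1 (suc L) (suc a) = Poly.refl L

bump : ∀ {L} → Fin L → (Fin L → ℕ) → Fin L → ℕ
bump i μ j = if ⌊ i ≟F j ⌋ then suc (μ j) else μ j

bump-suc : ∀ {L} i (μ : Fin (suc L) → ℕ) j → bump (suc i) μ (suc j) ≡ bump i (μ ∘ suc) j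
bump-suc i μ j = ≡.cong (if_then suc (μ (suc j)) else μ (suc j))
  (≡.trans (isYes≗does (suc i ≟F suc j)) (≡.sym (isYes≗does (i ≟F j))))

var-*-monomial : ∀ L i μ → Poly._≈_ L (Poly._*_ L (vars L i) (monomial L μ)) (monomial L (bump i μ))
var-*-monomial (suc L) zero    μ a = Poly.trans L (ElementaryCoefficients.var-zero-⋆ L (monomial (suc L) μ) a) (at a)
  where
  at : ∀ a → Poly._≈_ L (Convolution.delay (polynomialRing L) (monomial (suc L) μ) a) (monomial (suc L) (bump zero μ) a)
  at zero    = Poly.refl L
  at (suc a) = Poly.refl L
var-*-monomial (suc L) (suc i) μ a = trans (constant-⋆ (vars L i) (monomial (suc L) μ) a) (at (μ zero ≡ᵇ a))
  where
  open Poly L hiding (zero; _≈_)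
  open Convolution (polynomialRing L)
  at : ∀ b → Poly._≈_ L (vars L i * (if b then monomial L (μ ∘ suc) else 0#))
                        (if b then monomial L (bump (suc i) μ ∘ suc) else 0#)
  at true  = trans (var-*-monomial L i (μ ∘ suc)) (monomial-cong L (λ j → ≡.sym (bump-suc i μ j)))
  at false = zeroʳ _

countB-tabulate : ∀ {A : Set} {n} (p : A → Bool) (f : Fin n → A) → countB p (tabulate f) ≡ countB (p ∘ f) (allFin n)
countB-tabulate {n = zero}  p f = ≡.refl
countB-tabulate {n = suc n} p f = ≡.cong (λ c → if p (f zero) then suc c else c)
  (≡.trans (countB-tabulate p (f ∘ suc)) (≡.sym (countB-tabulate (p ∘ f) suc)))

allB-tabulate : ∀ {A : Set} {n} (p : A → Bool) (f : Fin n → A) → allB p (tabulate f) ≡ allB (p ∘ f) (allFin n)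
allB-tabulate {n = zero}  p f = ≡.refl
allB-tabulate {n = suc n} p f = ≡.cong (p (f zero) ∧_)
  (≡.trans (allB-tabulate p (f ∘ suc)) (≡.sym (allB-tabulate (p ∘ f) suc)))

content : ∀ {N L} → (Fin N → Fin L) → Fin L → ℕ
content {N} κ i = countB (λ v → ⌊ κ v ≟F i ⌋) (allFin N)

mono-monomial : ∀ L {N} (κ : Fin N → Fin L) →
  Poly._≈_ L (Colouring.mono (polynomialRing L) (vars L) (vars L) κ) (monomial L (content κ))
mono-monomial L {zero}  κ = monomial-1 L
mono-monomial L {suc N} κ = trans (*-congˡ (mono-monomial L (κ ∘ suc)))
  (trans (var-*-monomial L (κ zero) (content (κ ∘ suc))) (monomial-cong L (λ i →
    ≡.cong (λ c → if ⌊ κ zero ≟F i ⌋ then suc c else c) (≡.sym (countB-tabulate (λ v → ⌊ κ v ≟F i ⌋) suc)))))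
  where open Poly L using (trans; *-congˡ)

indicator : Bool → ℤ
indicator b = if b then + 1 else + 0

coeff-monomial : ∀ α μ → coeff α (monomial (length α) μ) ≡
                 indicator (allB (λ i → μ i ≡ᵇ lookup α i) (allFin (length α)))
coeff-monomial []      μ = ≡.refl
coeff-monomial (a ∷ α) μ with μ zero ≡ᵇ a
... | true  = ≡.trans (coeff-monomial α (μ ∘ suc))
  (≡.cong indicator (≡.sym (allB-tabulate (λ i → μ i ≡ᵇ lookup (a ∷ α) i) suc)))
... | false = coeff-0 α

sumℤ-indicator : ∀ {A : Set} (p : A → Bool) xs → sumℤ (map (indicator ∘ p) xs) ≡ + countB p xs
sumℤ-indicator p []       = ≡.refl
sumℤ-indicator p (x ∷ xs) with p x
... | true  = ≡.cong (ℤ._+_ (+ 1)) (sumℤ-indicator p xs)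
... | false = ≡.trans (ℤₚ.+-identityˡ _) (sumℤ-indicator p xs)

module ChromaticCoefficients (α : Mono) where
  private L = length α
  open Poly L hiding (zero; _≈_)
  open Algebra.Properties.Semiring.Sum semiring using (sum)
  open Colouring (polynomialRing L) (vars L)

  coeff-sum : ∀ {A : Set} {n} (f : A → Carrier) (g : Fin n → A) →
              coeff α (sum (f ∘ g)) ≡ sumℤ (map (coeff α ∘ f) (tabulate g))
  coeff-sum {n = zero}  f g = coeff-0 α
  coeff-sum {n = suc n} f g = ≡.trans (coeff-+ α (f (g zero)) _) (≡.cong (ℤ._+_ (coeff α (f (g zero)))) (coeff-sum f (g ∘ suc)))

  coeff-sumF : ∀ N φ → coeff α (sumF N φ) ≡ sumℤ (map (coeff α ∘ φ) (allFuns N L))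
  coeff-sumF zero    φ = ≡.sym (ℤₚ.+-identityʳ _)
  coeff-sumF (suc N) φ = begin
    coeff α (sumF (suc N) φ)
      ≡⟨ coeff-sum (λ c → sumF N (λ κ → φ (consF c κ))) id ⟩
    sumℤ (map (λ c → coeff α (sumF N (λ κ → φ (consF c κ)))) (allFin L))
      ≡⟨ ≡.cong sumℤ (map-cong (λ c → ≡.trans (coeff-sumF N (λ κ → φ (consF c κ)))
           (≡.cong sumℤ (map-∘ {g = coeff α ∘ φ} {f = consF c} (allFuns N L)))) (allFin L)) ⟩
    sumℤ (map (λ c → sumℤ (map (coeff α ∘ φ) (map (consF c) (allFuns N L)))) (allFin L))
      ≡⟨ sumℤ-concatMap (coeff α ∘ φ) (λ c → map (consF c) (allFuns N L)) (allFin L) ⟨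
    sumℤ (map (coeff α ∘ φ) (allFuns (suc N) L)) ∎
    where open ≡.≡-Reasoning

  coeff-weighted : ∀ G κ → coeff α (weighted G (λ _ → 1#) κ) ≡ indicator (proper (EGraph.E G) κ ∧ hasContent α κ)
  coeff-weighted G κ with proper (EGraph.E G) κ
  ... | true  = ≡.trans
    (coeff-cong α (trans (*-identityʳ _) (trans (*-identityˡ _) (mono-monomial L κ))))
    (coeff-monomial α (content κ))
  ... | false = ≡.trans (coeff-cong α (trans (*-identityʳ _) (zeroˡ _))) (coeff-0 α)

  coeff-chromatic : ∀ G → coeff α (chromatic G) ≡ X G α
  coeff-chromatic G = ≡.trans (coeff-sumF (EGraph.N G) (weighted G (λ _ → 1#)))
    (≡.trans (≡.cong sumℤ (map-cong (coeff-weighted G) (allFuns (EGraph.N G) L)))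
             (sumℤ-indicator _ (allFuns (EGraph.N G) L)))

restrict-X : ∀ L G → Poly._≈_ L (restrict L (X G)) (Colouring.chromatic (polynomialRing L) (vars L) G)
restrict-X L G = coeff-ext (λ L → restrict L (X G)) (λ L → Colouring.chromatic (polynomialRing L) (vars L) G)
  (λ α → ≡.trans (coeff-restrict (X G) α) (≡.sym (ChromaticCoefficients.coeff-chromatic α G))) L

open import Data.Nat using (_+_)
open import Data.Integer using (_-_)

≡ᵇ-+-cancelˡ : ∀ m x y → (m + x ≡ᵇ m + y) ≡ (x ≡ᵇ y)
≡ᵇ-+-cancelˡ zero    x y = ≡.refl
≡ᵇ-+-cancelˡ (suc m) x y = ≡ᵇ-+-cancelˡ m x y

-- After cancelling `suc a`, the `+ 2` has split: one successor is absorbed by m = n + 1, the other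
-- remains as the shift built into `products`. The subtraction is exact since a ≤ n.
triple-index : ∀ k n a b c → a ≤ n → (a + b + c + 2 ≡ᵇ k + suc n) ≡ (suc (b + c) ≡ᵇ k + (n ∸ a))
triple-index k n a b c a≤n = ≡.trans (≡.cong₂ _≡ᵇ_ (left a b c) (≡.trans
    (≡.cong (λ j → k + suc j) (≡.sym (ℕₚ.m+[n∸m]≡n a≤n))) (right k a (n ∸ a))))
  (≡ᵇ-+-cancelˡ (suc a) (suc (b + c)) (k + (n ∸ a)))
  where
  left : ∀ a b c → a + b + c + 2 ≡ suc a + suc (b + c)
  left = solve-∀
  right : ∀ k a r → k + suc (a + r) ≡ suc a + (k + r)
  right = solve-∀

-- Both sides of the theorem in L variables, with m = n + 1

module Assembly (L : ℕ) (G H : RootedGraph) (n h g k : ℕ) where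
  open Poly L using (Carrier; 1#; refl; sym; trans; reflexive; setoid; semiring; commutativeSemiring; +-abelianGroup;
    +-cong; +-congˡ; +-congʳ; +-assoc; +-identityʳ; *-cong; *-congˡ; *-comm; *-identityˡ; zeroʳ; -‿cong; -‿inverseˡ; distribˡ)
    renaming (_+_ to _⊞_; _*_ to _⊡_; _-_ to _⊟_; -_ to ⊟_)
  open Convolution (polynomialRing L)
  open Elementary (polynomialRing L)
  open Transfer (polynomialRing L) (vars L) hiding (_≋_)
  open Colouring (polynomialRing L) (vars L)
  open FiniteSums (polynomialRing L)
  open RestrictSum L
  open Algebra.Properties.Semiring.Sum semiring using (sum; sum-cong-≋; *-distribˡ-sum)
  open Algebra.Properties.Semiring.Mult semiring using (×-assoc-*; ×-congʳ) renaming (_×_ to _⊠_)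
  open Algebra.Properties.AbelianGroup +-abelianGroup using (∙-cancelʳ)
  open Algebra.Solver.Ring.NaturalCoefficients.Default commutativeSemiring
    using (solve; _:=_; _:+_; _:*_)
  open Relation.Binary.Reasoning.Setoid setoid

  F F′ : Fun
  F  = B^ g (minus G)
  F′ = B^ h (minus H)

  factorial : Carrier
  factorial = (n !) ⊠ 1#

  pathTerm : ℕ → SF
  pathTerm z = e (suc n ∸ 1 ∸ z) ⊛ X (P (g + h + k + z) G H)

  tailTerm : ℕ × ℕ × ℕ → SF
  tailTerm (a , b , c) = (+ 1 - + a) · (e a ⊛ (X (tailG G (b + g)) ⊛ X (tailG H (c + h))))

  lollipopTerm : ℕ → SF
  lollipopTerm z = X (lollipop (suc n) z) ⊛ X (P (g + h + k ∸ z ∸ 1) G H)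

  -- The path is cut into three stretches: g steps stay with `G`, h steps cross over to `H` by
  -- self-adjointness, and the middle j steps index `pairs`.
  restrict-P : ∀ j → restrict L (X (P (g + h + j) G H)) ≋ pairs F F′ j
  restrict-P j = begin
    restrict L (X (P (g + h + j) G H))       ≈⟨ trans (restrict-X L (P (g + h + j) G H)) (chromatic-P (g + h + j) G H) ⟩
    pair (B^ (g + h + j) (minus G)) (minus H)
      ≡⟨ ≡.cong (λ i → pair (B^ i (minus G)) (minus H)) (order g h j) ⟩
    pair (B^ (h + (j + g)) (minus G)) (minus H)
      ≡⟨ ≡.cong (λ u → pair u (minus H)) (≡.trans (B^-+ h (j + g) (minus G)) (≡.cong (B^ h) (B^-+ j g (minus G)))) ⟩
    pair (B^ h (B^ j F)) (minus H)           ≈⟨ B^-selfAdjoint h (B^ j F) (minus H) ⟩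
    pairs F F′ j                             ∎
    where
    order : ∀ g h j → g + h + j ≡ h + (j + g)
    order = solve-∀

  restrict-tailG : ∀ R j i → restrict L (X (tailG R (j + i))) ≋ totals (B^ i (minus R)) j
  restrict-tailG R j i = trans (restrict-X L (tailG R (j + i))) (trans (chromatic-tailG R (j + i))
    (reflexive (≡.cong total (B^-+ j i (minus R)))))

  restrict-lollipop : ∀ z → restrict L (X (lollipop (suc n) z)) ≋ factorial ⊡ totals (E n) z
  restrict-lollipop z = trans (restrict-X L (lollipop (suc n) z)) (trans (chromatic-tailG (K (suc n)) z)
    (trans (total-cong (λ i → trans (B^-cong z (minus-K n) i) (B^-scale z factorial (E n) i)))
           (total-scale factorial (B^ z (E n)))))

  restrict-spider : restrict L (X (spider g h k G H (K (suc n)))) ≋ factorial ⊡ triple F F′ (B^ k (E n))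
  restrict-spider = trans (restrict-X L (spider g h k G H (K (suc n)))) (trans (chromatic-spider g h k G H (K (suc n)))
    (trans (total-cong (λ i → trans
             (*-congˡ (trans (B^-cong k (minus-K n) i) (B^-scale k factorial (E n) i)))
             (solve 3 (λ p q r → p :* (q :* r) := q :* (p :* r)) refl _ _ _)))
           (total-scale factorial _)))

  restrict-pathTerms : restrictSum pathTerm (upTo (suc n)) ≋ (eₓ ⋆ (λ z → pairs F F′ (k + z))) n
  restrict-pathTerms = begin
    restrictSum pathTerm (upTo (suc n))
      ≈⟨ restrictSum-applyUpTo pathTerm id (suc n) ⟩
    sum {suc n} (λ i → restrict L (pathTerm (toℕ i)))
      ≈⟨ sum-cong-≋ {suc n} (λ i → trans (restrict-⊛ L (e (n ∸ toℕ i)) _) (trans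
           (*-cong (restrict-e L (n ∸ toℕ i))
             (trans (reflexive (≡.cong (λ j → restrict L (X (P j G H))) (ℕₚ.+-assoc (g + h) k (toℕ i)))) (restrict-P (k + toℕ i))))
           (*-comm _ _))) ⟩
    sum {suc n} (λ i → pairs F F′ (k + toℕ i) ⊡ eₓ (n ∸ toℕ i))
      ≈⟨ ⋆-sum (λ z → pairs F F′ (k + z)) eₓ n ⟨
    ((λ z → pairs F F′ (k + z)) ⋆ eₓ) n
      ≈⟨ ⋆-comm _ eₓ n ⟩
    (eₓ ⋆ (λ z → pairs F F′ (k + z))) n ∎

  restrict-tailTerm : ∀ a b c → restrict L (tailTerm (a , b , c)) ≋ d a ⊡ (totals F b ⊡ totals F′ c)
  restrict-tailTerm a b c = begin
    restrict L (tailTerm (a , b , c))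
      ≈⟨ restrict-·1- a _ ⟩
    restrict L q ⊟ a ⊠ restrict L q
      ≈⟨ +-cong product (-‿cong (×-congʳ a product)) ⟩
    eₓ a ⊡ t ⊟ a ⊠ (eₓ a ⊡ t)
      ≈⟨ +-congˡ (-‿cong (×-assoc-* a (eₓ a) t)) ⟨
    eₓ a ⊡ t ⊟ (a ⊠ eₓ a) ⊡ t
      ≈⟨ [y-z]x≈yx-zx t (eₓ a) (a ⊠ eₓ a) ⟨
    d a ⊡ t ∎
    where
    open Algebra.Properties.Ring (Poly.ring L) using ([y-z]x≈yx-zx)
    q = e a ⊛ (X (tailG G (b + g)) ⊛ X (tailG H (c + h)))
    t = totals F b ⊡ totals F′ c
    product : restrict L q ≋ eₓ a ⊡ t
    product = trans (restrict-⊛ L (e a) _) (*-cong (restrict-e L a)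
      (trans (restrict-⊛ L (X (tailG G (b + g))) _) (*-cong (restrict-tailG G b g) (restrict-tailG H c h))))

  -- For fixed a the indices b and c run over one antidiagonal, so the triple sum is a convolution
  -- of `d` with shifted products.
  restrict-tailTerms : restrictSum tailTerm (triples k (suc n)) ≋ (d ⋆ (λ j → products F F′ (k + j))) n
  restrict-tailTerms = trans (restrictSum-triples tailTerm k (suc n)) (trans
    (sum-cong-≋ {suc n} (λ i → slice (toℕ i) (ℕ.s≤s⁻¹ (toℕ<n i))))
    (sym (⋆-sum d (λ j → products F F′ (k + j)) n)))
    where
    M = k + suc n
    cell : ∀ a b c → a ≤ n →
      ⟦ a + b + c + 2 ≡ᵇ M ⟧ ⊡ restrict L (tailTerm (a , b , c)) ≋
      d a ⊡ (⟦ suc (b + c) ≡ᵇ k + (n ∸ a) ⟧ ⊡ (totals F b ⊡ totals F′ c))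
    cell a b c a≤n = trans (*-cong (⟦⟧-cong (triple-index k n a b c a≤n)) (restrict-tailTerm a b c))
      (solve 3 (λ p q r → p :* (q :* r) := q :* (p :* r)) refl _ _ _)
    slice : ∀ a → a ≤ n →
      sum {M} (λ b → sum {M} (λ c → ⟦ a + toℕ b + toℕ c + 2 ≡ᵇ M ⟧ ⊡ restrict L (tailTerm (a , toℕ b , toℕ c)))) ≋
      d a ⊡ products F F′ (k + (n ∸ a))
    slice a a≤n = begin
      sum {M} (λ b → sum {M} (λ c → ⟦ a + toℕ b + toℕ c + 2 ≡ᵇ M ⟧ ⊡ restrict L (tailTerm (a , toℕ b , toℕ c))))
        ≈⟨ sum-cong-≋ {M} (λ b → trans (sum-cong-≋ {M} (λ c → cell a (toℕ b) (toℕ c) a≤n)) (sym (*-distribˡ-sum {M} (d a) _))) ⟩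
      sum {M} (λ b → d a ⊡ sum {M} (λ c → ⟦ suc (toℕ b + toℕ c) ≡ᵇ k + (n ∸ a) ⟧ ⊡ (totals F (toℕ b) ⊡ totals F′ (toℕ c))))
        ≈⟨ *-distribˡ-sum {M} (d a) _ ⟨
      d a ⊡ sum {M} (λ b → sum {M} (λ c → ⟦ suc (toℕ b + toℕ c) ≡ᵇ k + (n ∸ a) ⟧ ⊡ (totals F (toℕ b) ⊡ totals F′ (toℕ c))))
        ≈⟨ *-congˡ (sum-antidiagonal M M (k + (n ∸ a)) (totals F) (totals F′) bound bound) ⟩
      d a ⊡ products F F′ (k + (n ∸ a)) ∎
      where
      bound : k + (n ∸ a) ≤ M
      bound = ℕₚ.+-monoʳ-≤ k (ℕₚ.≤-trans (ℕₚ.m∸n≤m n a) (ℕₚ.n≤1+n n))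

  -- Both truncated subtractions are exact because z ≤ k; the final `∸ 1` removes the successor of
  -- `suc k`.
  lollipop-index : ∀ k z → z ≤ k → g + h + suc k ∸ z ∸ 1 ≡ g + h + (k ∸ z)
  lollipop-index k z z≤k = ≡.trans (ℕₚ.∸-+-assoc (g + h + suc k) z 1) (≡.trans
    (≡.cong₂ _∸_ (ℕₚ.+-suc (g + h) k) (ℕₚ.+-comm z 1)) (ℕₚ.+-∸-assoc (g + h) z≤k))

  restrict-lollipopTerms : restrictSum lollipopTerm (upTo k) ≋ factorial ⊡ delay (totals (E n) ⋆ pairs F F′) k
  restrict-lollipopTerms = trans (restrictSum-applyUpTo lollipopTerm id k) (terms k)
    where
    -- The length is quantified afresh, since the case split that unfolds `delay` cannot be made on
    -- the fixed module parameter.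
    terms : ∀ k → sum {k} (λ i → restrict L (X (lollipop (suc n) (toℕ i)) ⊛ X (P (g + h + k ∸ toℕ i ∸ 1) G H))) ≋
                  factorial ⊡ delay (totals (E n) ⋆ pairs F F′) k
    terms zero    = sym (zeroʳ _)
    terms (suc k) = trans
      (sum-cong-≋ {suc k} (λ i → trans (restrict-⊛ L (X (lollipop (suc n) (toℕ i))) _) (trans
        (*-cong (restrict-lollipop (toℕ i)) (trans
          (reflexive (≡.cong (λ j → restrict L (X (P j G H))) (lollipop-index k (toℕ i) (ℕ.s≤s⁻¹ (toℕ<n i)))))
          (restrict-P (k ∸ toℕ i))))
        (Poly.*-assoc L _ _ _))))
      (trans (sym (*-distribˡ-sum {suc k} factorial (λ i → totals (E n) (toℕ i) ⊡ pairs F F′ (k ∸ toℕ i)))) (*-congˡ (sym (⋆-sum (totals (E n)) (pairs F F′) k))))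

  -- Agrees definitionally with the right-hand side of the theorem at m = n + 1, so nothing remains
  -- to be transported at the end.
  rhs : SF
  rhs = (+ (n !)) · (sumSF (map pathTerm (upTo (suc n))) ⊖ sumSF (map tailTerm (triples k (suc n))))
        ⊕ sumSF (map lollipopTerm (upTo k))

  spider-rhs : restrict L (X (spider g h k G H (K (suc n)))) ≋ restrict L rhs
  spider-rhs = begin
    restrict L (X (spider g h k G H (K (suc n))))
      ≈⟨ restrict-spider ⟩
    factorial ⊡ triple F F′ (B^ k (E n))
      -- `triple-B^E` has the products of tails on the left; cancelling `neg` restores the minus
      -- sign of the statement.
      ≈⟨ *-congˡ (∙-cancelʳ neg _ _ (begin
           triple F F′ (B^ k (E n)) ⊞ neg  ≈⟨ triple-B^E k n F F′ ⟩
           pos₁ ⊞ pos₂                     ≈⟨ +-identityʳ _ ⟨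
           pos₁ ⊞ pos₂ ⊞ Poly.0# L         ≈⟨ +-congˡ (-‿inverseˡ neg) ⟨
           pos₁ ⊞ pos₂ ⊞ (⊟ neg ⊞ neg)
             ≈⟨ solve 4 (λ p q r s → p :+ q :+ (r :+ s) := p :+ r :+ q :+ s) refl _ _ _ _ ⟩
           pos₁ ⊟ neg ⊞ pos₂ ⊞ neg         ∎)) ⟩
    factorial ⊡ (pos₁ ⊟ neg ⊞ pos₂)
      ≈⟨ distribˡ _ _ _ ⟩
    factorial ⊡ (pos₁ ⊟ neg) ⊞ factorial ⊡ pos₂
      ≈⟨ +-cong (trans (×-congʳ (n !) (sym (*-identityˡ _))) (sym (×-assoc-* (n !) 1# _))) refl ⟨
    (n !) ⊠ (pos₁ ⊟ neg) ⊞ factorial ⊡ pos₂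
      ≈⟨ +-cong (×-congʳ (n !) (+-cong restrict-pathTerms (-‿cong restrict-tailTerms))) restrict-lollipopTerms ⟨
    (n !) ⊠ (restrictSum pathTerm (upTo (suc n)) ⊟ restrictSum tailTerm (triples k (suc n))) ⊞ restrictSum lollipopTerm (upTo k)
      ≈⟨ trans (restrict-⊕ L (+ (n !) · _) _) (+-congʳ (trans (restrict-·ℕ (n !) _) (×-congʳ (n !) (restrict-⊖ L _ _)))) ⟨
    restrict L rhs ∎
    where
    pos₁ = (eₓ ⋆ (λ z → pairs F F′ (k + z))) n
    pos₂ = delay (totals (E n) ⋆ pairs F F′) k
    neg  = (d ⋆ (λ j → products F F′ (k + j))) n

theorem4p5 : (G H : RootedGraph) (m h g k : ℕ) → 1 ≤ m → 1 ≤ h →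
    X (spider g h k G H (K m))
    ≈ (+ ((m ∸ 1) !)) ·
    ( sumSF (map (λ z → e (m ∸ 1 ∸ z) ⊛ X (P (g + h + k + z) G H)) (upTo m))
    ⊖ sumSF (map (λ { (a , b , c) → (+ 1 - + a) · (e a ⊛ (X (tailG G (b + g)) ⊛ X (tailG H (c + h)))) })
    (triples k m)) )
    ⊕ sumSF (map (λ z → X (lollipop m z) ⊛ X (P (g + h + k ∸ z ∸ 1) G H)) (upTo k))
-- The number of variables is taken to be `length α`, so that α addresses a single coefficient of
-- the ring equation.
theorem4p5 G H (suc n) h g k _ _ α = ≡.trans
  (≡.sym (coeff-restrict (X (spider g h k G H (K (suc n)))) α))
  (≡.trans (coeff-cong α spider-rhs) (coeff-restrict rhs α))
  where open Assembly (length α) G H n h g k
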